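{- Let $p$ be a prime, let $k\ge p$ and $m\ge 2$ be integers, and let $L\subseteq\mathbb{Z}/p\mathbb{Z}$ have size $p-1$. Then $r(k,L,m)=\Omega_k\!\left(m^{ -\lceil k/p\rceil-1}\right)$ and $r(k,L,m)=O_k\!\left(m^{ -\lfloor k/p\rfloor+1}\right)$. Moreover, when $L=(\mathbb{Z}/p\mathbb{Z})\setminus\{0\}$ and $k$ is a multiple of $p$, we have $r(k,L,m)=\Theta_k\!\left(m^{ -k/p}\right)$.
   Context: Sets $F_1,\dots,F_t$ form an $L$-clique of size $t$ if $|F_i\cap F_j|\in L$ for all $i<j$. A family avoids intersections of size in $L$ if no two distinct members $F,F'$ satisfy $|F\cap F'|\in L$. For integers $k\ge1,m\ge2$ and $L\subseteq\{0,\dots,k-1\}$, $r(k,L,m)$ is the supremum of all $\alpha\ge 0$ such that whenever a finite set system $\mathcal F$ of $k$-element sets contains no $L$-clique of size $m$, there is $\mathcal F'\subseteq\mathcal F$ with $|\mathcal F'|\ge \alpha|\mathcal F|$ avoiding intersections of size in $L$. For $L\subseteq\mathbb Z/p\mathbb Z$, $r(k,L,m)$ means $r(k,L',m)$ with $L'=\{\ell\in\{0,\dots,k-1\}:\ell \bmod p\in L\}$. The notation $\Omega_k,O_k,\Theta_k$ hides multiplicative constants depending only on $k$. -}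

module Defs where

open import Data.Nat as ℕ using (ℕ; _<_; _∸_; _+_; NonZero)
open import Data.Nat.DivMod using (_mod_; _/_)
open import Data.Nat.Primality using (Prime; prime⇒nonZero)
open import Data.Integer using (+_)
open import Data.Rational as ℚ using (ℚ)
open import Data.Fin using (Fin)
open import Data.Fin.Subset using (Subset; _∈_; _∩_; ∣_∣; ∁; ⁅_⁆)
open import Data.List using (List; length)
open import Data.List.Relation.Unary.All using (All)
open import Data.List.Relation.Unary.AllPairs using (AllPairs)
open import Data.List.Relation.Unary.Unique.Propositional using (Unique)
open import Data.List.Relation.Binary.Sublist.Propositional using (_⊆_)
open import Data.Product using (Σ; _×_)
open import Relation.Nullary using (¬_)
open import Relation.Binary.PropositionalEquality using (_≡_)

ℕ→ℚ : ℕ → ℚ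
ℕ→ℚ n = (+ n) ℚ./ 1

_∈mod[_,_]_ : ℕ → (p : ℕ) → Prime p → Subset p → Set
ℓ ∈mod[ p , pr ] L = let instance _ = prime⇒nonZero pr in (ℓ mod p) ∈ L

InL' : (k p : ℕ) → Prime p → Subset p → ℕ → Set
InL' k p pr L ℓ = ℓ < k × ℓ ∈mod[ p , pr ] L

IsKSystem : (k n : ℕ) → List (Subset n) → Set
IsKSystem k n 𝓕 = Unique 𝓕 × All (λ F → ∣ F ∣ ≡ k) 𝓕

IntIn : {n : ℕ} → (ℕ → Set) → Subset n → Subset n → Set
IntIn P F G = P ∣ F ∩ G ∣

HasClique : {n : ℕ} → (ℕ → Set) → ℕ → List (Subset n) → Set
HasClique P m 𝓕 = Σ (List _) λ 𝓒 → 𝓒 ⊆ 𝓕 × length 𝓒 ≡ m × AllPairs (IntIn P) 𝓒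

Avoids : {n : ℕ} → (ℕ → Set) → List (Subset n) → Set
Avoids P 𝓕 = AllPairs (λ F G → ¬ IntIn P F G) 𝓕

Admissible : (k : ℕ) → (ℕ → Set) → (m : ℕ) → ℚ → Set
Admissible k P m α =
  ∀ (n : ℕ) (𝓕 : List (Subset n)) → IsKSystem k n 𝓕 → ¬ HasClique P m 𝓕 →
  Σ (List (Subset n)) λ 𝓕' → 𝓕' ⊆ 𝓕 × Avoids P 𝓕' ×
    α ℚ.* ℕ→ℚ (length 𝓕) ℚ.≤ ℕ→ℚ (length 𝓕')

-- x ≤ r(k,P,m) = sup { α ≥ 0 : Admissible k P m α }  (literal sup reading:
-- every β < x is below some admissible α; admissibility is downward closed)
LowerBd : (k : ℕ) → (ℕ → Set) → (m : ℕ) → ℚ → Set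
LowerBd k P m x = ∀ β → β ℚ.< x → Σ ℚ λ α → ℚ.0ℚ ℚ.≤ α × Admissible k P m α × β ℚ.≤ α

UpperBd : (k : ℕ) → (ℕ → Set) → (m : ℕ) → ℚ → Set
UpperBd k P m y = ∀ α → ℚ.0ℚ ℚ.≤ α → Admissible k P m α → α ℚ.≤ y

-- 1/d for d ≥ 1 (value at 0 irrelevant; only used with d = m^a, m ≥ 2)
inv : ℕ → ℚ
inv 0 = ℚ.0ℚ
inv (ℕ.suc d) = (+ 1) ℚ./ ℕ.suc d

_·_^-_ : ℚ → ℕ → ℕ → ℚ
c · m ^- a = c ℚ.* inv (m ℕ.^ a)

⌊_/_⌋[_] : ℕ → (p : ℕ) → Prime p → ℕ
⌊ k / p ⌋[ pr ] = let instance _ = prime⇒nonZero pr in k / p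

⌈_/_⌉[_] : ℕ → (p : ℕ) → Prime p → ℕ
⌈ k / p ⌉[ pr ] = let instance _ = prime⇒nonZero pr in (k + (p ∸ 1)) / p

nonzeroRes : (p : ℕ) → Prime p → Subset p
nonzeroRes p pr = let instance _ = prime⇒nonZero pr in
  ∁ ⁅ 0 mod p ⁆

{-# OPTIONS --safe #-}
-- Only the residue r missing from L is allowed as an intersection size, up to a multiple of p.
--
-- Lower bounds.  Pass to a k-partite subfamily, so that sets become words and |F ∩ G| counts agreements.
-- A maximal L-clique has fewer than m members and every set meets one of them in r modulo p, so at the
-- cost of a factor O(m) all sets contain a common trace of size r modulo p.  It remains to make the
-- agreements on the remaining coordinates multiples of p.  Take the letter x of largest degree; applying the
-- same remark to the words through x, a fraction 1/O(m) of them agree on a set I ∋ x of coordinates with p ∣ |I|.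
-- Keep them and delete the other words meeting this block: by the choice of x this costs O(m) times what is
-- kept.  Iterating, at the cost of a factor O(m) any two words agree on all of I or nowhere on I, so the at least
-- p coordinates of I can be dropped; this happens at most ⌈k/p⌉ times.
--
-- Upper bounds.  Let k′ ≤ k be the largest integer congruent to r and take all words of length k′ over n
-- letters, padded by private elements to size k.  An L-clique has at most (k′n + 1)^(p-1) members because
-- the matrix ∏ (|F ∩ G| − k′ + l), 1 ≤ l < p, has that rank at most and is diagonal modulo p.  A family with all
-- agreements congruent to k′ has O(n^⌊k′/p⌋) members, since fixing one more common coordinate forces p
-- of them.  Now choose n with m of order n^(p-1).
module Submission where

open import Defs
open import Data.Nat.Base
open import Data.Nat.Properties
open import Data.Nat.Divisibility
open import Data.Nat.DivMod using (_%_; _/_; _mod_; m≡m%n+[m/n]*n; m%n<n; m<n⇒m%n≡m; m*n/n≡m; m/n*n≡m; m/n*n≤m; m/n≤m; n/n≡1; [m+n]%n≡m%n; [m+kn]%n≡m%n; /-monoˡ-≤; +-distrib-/-∣ʳ; %-distribˡ-+; %-distribˡ-*; %-remove-+ˡ; %-remove-+ʳ)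
open import Data.Nat.ListAction using (sum)
open import Data.Nat.ListAction.Properties using (sum-++)
open import Data.Nat.Primality using (Prime; euclidsLemma; prime⇒nonZero; prime⇒nonTrivial)
open import Data.Nat.Tactic.RingSolver using (solve-∀)
import Data.Integer.Base as ℤ
import Data.Integer.Properties as ℤ
open import Data.Rational as ℚ using (ℚ; 0ℚ; 1ℚ; toℚᵘ)
open import Data.Rational.Properties as ℚ using (toℚᵘ-fromℚᵘ; toℚᵘ-injective; toℚᵘ-homo-*; toℚᵘ-cancel-≤; toℚᵘ-cancel-<)
open import Data.Rational.Solver using (module +-*-Solver)
open import Data.Rational.Unnormalised as ℚᵘ using (mkℚᵘ; _≃_; *≡*; *≤*; *<*)
import Data.Rational.Unnormalised.Properties as ℚᵘ
open import Data.Bool.Base using (true; false)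
import Data.Bool.Properties as Bool
open import Data.Fin.Base using (Fin; zero; suc; toℕ; fromℕ<; splitAt; _↑ˡ_; _↑ʳ_; finToFun; funToFin; combine)
open import Data.Fin.Properties using (toℕ-fromℕ<; toℕ-injective; toℕ<n; splitAt-↑ˡ; splitAt-↑ʳ; injective⇒≤; finToFun-funToFin; funToFin-finToFin)
import Data.Fin.Properties as Fin
open import Data.Fin.Subset using (Subset; ∣_∣; _∩_; _∪_; ∁; ⁅_⁆; ⊤; ⊥; Nonempty; inside; outside) renaming (_∈_ to _∈ˢ_; _∉_ to _∉ˢ_; _⊆_ to _⊆ˢ_)
open import Data.Fin.Subset.Properties hiding (⊆-refl; ⊆-trans) renaming (x∈p∩q⁺ to ∈-∩⁺; x∈p∩q⁻ to ∈-∩⁻; _∈?_ to _∈ˢ?_; ⊆-antisym to ⊆ˢ-antisym; drop-there to drop-thereˢ)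
open import Data.Vec.Base as Vec using (Vec; []; _∷_; here; there)
import Data.Vec.Properties as Vec
open import Data.List.Base as List using (List; []; _∷_; _++_; map; length; filter; take; allFin; cartesianProduct; cartesianProductWith)
open import Data.List.Properties using (map-++; map-∘; map-tabulate; length-map; length-++; length-take; length-tabulate)
open import Data.List.Extrema ≤-totalOrder using (argmax; argmax-sel; f[xs]≤f[argmax]; f[⊥]≤f[argmax])
open import Data.List.Membership.Propositional using (_∈_; find)
open import Data.List.Membership.Propositional.Properties using (∈-filter⁺; ∈-filter⁻; ∈-cartesianProduct⁺; ∈-cartesianProduct⁻; ∈-allFin; ∈-++⁺ˡ; ∈-++⁺ʳ; ∈-map⁺; ∈-lookup)
open import Data.List.Relation.Unary.Any using (here; there; any?)
open import Data.List.Relation.Unary.All as All using (All; []; _∷_)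
import Data.List.Relation.Unary.All.Properties as All
open import Data.List.Relation.Unary.AllPairs as AllPairs using (AllPairs; []; _∷_)
import Data.List.Relation.Unary.AllPairs.Properties as AllPairs
open import Data.List.Relation.Unary.Unique.Propositional using (Unique)
import Data.List.Relation.Unary.Unique.Propositional.Properties as Unique
open import Data.List.Relation.Binary.Sublist.Propositional as Sublist using (_⊆_; []; _∷_; _∷ʳ_; ⊆-trans)
open import Data.List.Relation.Binary.Sublist.Propositional.Properties using (filter-⊆; All-resp-⊆; take-⊆; length-mono-≤)
open import Data.Product using (Σ; ∃; _×_; _,_; proj₁; proj₂; Σ-syntax; ∃-syntax)
open import Data.Sum using (_⊎_; inj₁; inj₂; [_,_]′)
import Data.Empty as Empty
open import Data.Unit.Base using (tt) renaming (⊤ to Unit)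
open import Function.Base using (_∘_; id; it)
open import Relation.Nullary using (Dec; yes; no; ¬_; does; contradiction)
open import Relation.Nullary.Decidable using (_×-dec_; _⊎-dec_; _→-dec_; ¬?; dec-true; dec-false; decidable-stable)
open import Relation.Unary using (Decidable)
open import Relation.Binary using (DecidableEquality)
open import Relation.Binary.PropositionalEquality
open import Algebra.Properties.CommutativeSemigroup +-commutativeSemigroup using () renaming (interchange to +-interchange)

private
  variable
    A B X : Set
    n k : ℕ

-- Sums and counts over lists

∑ : List A → (A → ℕ) → ℕ
∑ xs f = sum (map f xs)

∑-mono : ∀ (xs : List A) {f g : A → ℕ} → (∀ {x} → x ∈ xs → f x ≤ g x) → ∑ xs f ≤ ∑ xs g
∑-mono []       f≤g = z≤n
∑-mono (x ∷ xs) f≤g = +-mono-≤ (f≤g (here refl)) (∑-mono xs (f≤g ∘ there))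

∑-cong : ∀ (xs : List A) {f g : A → ℕ} → (∀ x → f x ≡ g x) → ∑ xs f ≡ ∑ xs g
∑-cong []       f≗g = refl
∑-cong (x ∷ xs) f≗g = cong₂ _+_ (f≗g x) (∑-cong xs f≗g)

∑-+ : ∀ (xs : List A) (f g : A → ℕ) → ∑ xs (λ x → f x + g x) ≡ ∑ xs f + ∑ xs g
∑-+ []       f g = refl
∑-+ (x ∷ xs) f g = trans (cong (f x + g x +_) (∑-+ xs f g)) (+-interchange (f x) (g x) _ _)

∑-*ˡ : ∀ (xs : List A) c (f : A → ℕ) → ∑ xs (λ x → c * f x) ≡ c * ∑ xs f
∑-*ˡ []       c f = sym (*-zeroʳ c)
∑-*ˡ (x ∷ xs) c f = trans (cong (c * f x +_) (∑-*ˡ xs c f)) (sym (*-distribˡ-+ c (f x) _))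

∑-*ʳ : ∀ (xs : List A) c (f : A → ℕ) → ∑ xs (λ x → f x * c) ≡ ∑ xs f * c
∑-*ʳ xs c f = trans (∑-cong xs (λ x → *-comm (f x) c)) (trans (∑-*ˡ xs c f) (*-comm c _))

∑-0 : ∀ (xs : List A) → ∑ xs (λ _ → 0) ≡ 0
∑-0 []       = refl
∑-0 (x ∷ xs) = ∑-0 xs

∑-swap : ∀ (xs : List A) (ys : List B) (f : A → B → ℕ) →
  ∑ xs (λ x → ∑ ys (f x)) ≡ ∑ ys (λ y → ∑ xs (λ x → f x y))
∑-swap []       ys f = sym (∑-0 ys)
∑-swap (x ∷ xs) ys f = trans (cong (∑ ys (f x) +_) (∑-swap xs ys f)) (sym (∑-+ ys (f x) _))

∑-++ : ∀ (xs ys : List A) (f : A → ℕ) → ∑ (xs ++ ys) f ≡ ∑ xs f + ∑ ys f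
∑-++ xs ys f = trans (cong sum (map-++ f xs ys)) (sum-++ (map f xs) (map f ys))

∑-map : ∀ (xs : List A) (g : A → B) (f : B → ℕ) → ∑ (map g xs) f ≡ ∑ xs (f ∘ g)
∑-map xs g f = cong sum (sym (map-∘ xs))

∑-cartesianProductWith : ∀ {C : Set} (g : A → B → C) (as : List A) (bs : List B) (f : C → ℕ) →
  ∑ (cartesianProductWith g as bs) f ≡ ∑ as (λ a → ∑ bs (λ b → f (g a b)))
∑-cartesianProductWith g []       bs f = refl
∑-cartesianProductWith g (a ∷ as) bs f = trans (∑-++ (map (g a) bs) _ f)
  (cong₂ _+_ (∑-map bs (g a) f) (∑-cartesianProductWith g as bs f))

∑-const : ∀ (xs : List A) c → ∑ xs (λ _ → c) ≡ length xs * c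
∑-const []       c = refl
∑-const (x ∷ xs) c = cong (c +_) (∑-const xs c)

∑≤length* : ∀ (xs : List A) {f : A → ℕ} {c} → (∀ {x} → x ∈ xs → f x ≤ c) → ∑ xs f ≤ length xs * c
∑≤length* xs f≤c = ≤-trans (∑-mono xs f≤c) (≤-reflexive (∑-const xs _))

∈⇒≤∑ : ∀ {xs : List A} {x} (f : A → ℕ) → x ∈ xs → f x ≤ ∑ xs f
∈⇒≤∑ f (here refl) = m≤m+n _ _
∈⇒≤∑ f (there x∈)  = ≤-trans (∈⇒≤∑ f x∈) (m≤n+m _ _)

∃-max : ∀ (f : A → ℕ) {y} {xs : List A} → y ∈ xs → ∃[ x ] x ∈ xs × (∀ {z} → z ∈ xs → f z ≤ f x)
∃-max f {xs = x ∷ xs} _ = argmax f x xs , sel (argmax-sel f x xs) , bound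
  where
  sel : argmax f x xs ≡ x ⊎ argmax f x xs ∈ xs → argmax f x xs ∈ x ∷ xs
  sel (inj₁ eq) = here eq
  sel (inj₂ i)  = there i
  bound : ∀ {z} → z ∈ x ∷ xs → f z ≤ f (argmax f x xs)
  bound (here refl) = f[⊥]≤f[argmax] {f = f} x xs
  bound (there z∈)  = All.lookup (f[xs]≤f[argmax] {f = f} x xs) z∈

∃-popular : ∀ (f : A → ℕ) {y} {xs : List A} → y ∈ xs → ∃[ x ] x ∈ xs × ∑ xs f ≤ length xs * f x
∃-popular f {xs = xs} y∈ with ∃-max f y∈
... | x , x∈ , max = x , x∈ , ∑≤length* xs max

𝟙 : ∀ {P : Set} → Dec P → ℕ
𝟙 (yes _) = 1
𝟙 (no  _) = 0

𝟙-mono : ∀ {P Q : Set} (P? : Dec P) (Q? : Dec Q) → (P → Q) → 𝟙 P? ≤ 𝟙 Q?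
𝟙-mono (yes p) (yes q) f = ≤-refl
𝟙-mono (yes p) (no ¬q) f = contradiction (f p) ¬q
𝟙-mono (no ¬p) Q?      f = z≤n

𝟙-cong : ∀ {P Q : Set} (P? : Dec P) (Q? : Dec Q) → (P → Q) → (Q → P) → 𝟙 P? ≡ 𝟙 Q?
𝟙-cong P? Q? f g = ≤-antisym (𝟙-mono P? Q? f) (𝟙-mono Q? P? g)

𝟙-yes : ∀ {P : Set} (P? : Dec P) → P → 𝟙 P? ≡ 1
𝟙-yes (yes _) p = refl
𝟙-yes (no ¬p) p = contradiction p ¬p

𝟙-no : ∀ {P : Set} (P? : Dec P) → ¬ P → 𝟙 P? ≡ 0
𝟙-no (yes p) ¬p = contradiction p ¬p
𝟙-no (no _)  ¬p = refl

# : {P : X → Set} → Decidable P → List X → ℕ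
# P? xs = ∑ xs (λ x → 𝟙 (P? x))

length-filter≡# : {P : X → Set} (P? : Decidable P) (xs : List X) → length (filter P? xs) ≡ # P? xs
length-filter≡# P? []       = refl
length-filter≡# P? (x ∷ xs) with P? x
... | yes _ = cong suc (length-filter≡# P? xs)
... | no  _ = length-filter≡# P? xs

#-mono : {P Q : X → Set} (P? : Decidable P) (Q? : Decidable Q) (xs : List X) →
  (∀ {x} → x ∈ xs → P x → Q x) → # P? xs ≤ # Q? xs
#-mono P? Q? xs P⇒Q = ∑-mono xs (λ x∈ → 𝟙-mono (P? _) (Q? _) (P⇒Q x∈))

#-⊎ : {P Q R : X → Set} (P? : Decidable P) (Q? : Decidable Q) (R? : Decidable R) (xs : List X) →
  (∀ {x} → x ∈ xs → P x → Q x ⊎ R x) → # P? xs ≤ # Q? xs + # R? xs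
#-⊎ {P = P} {Q = Q} {R = R} P? Q? R? xs f =
  ≤-trans (∑-mono xs (λ x∈ → pointwise (P? _) (Q? _) (R? _) (f x∈))) (≤-reflexive (∑-+ xs _ _))
  where
  pointwise : ∀ {P Q R : Set} (P? : Dec P) (Q? : Dec Q) (R? : Dec R) → (P → Q ⊎ R) → 𝟙 P? ≤ 𝟙 Q? + 𝟙 R?
  pointwise (no _)  _       _       f = z≤n
  pointwise (yes p) (yes q) _       f = s≤s z≤n
  pointwise (yes p) (no _)  (yes r) f = ≤-refl
  pointwise (yes p) (no ¬q) (no ¬r) f = contradiction (f p) [ ¬q , ¬r ]′

#-disjoint : {P Q R : X → Set} (P? : Decidable P) (Q? : Decidable Q) (R? : Decidable R) (xs : List X) →
  (∀ {x} → P x → R x) → (∀ {x} → Q x → R x) → (∀ {x} → P x → ¬ Q x) → # P? xs + # Q? xs ≤ # R? xs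
#-disjoint P? Q? R? xs f g h =
  ≤-trans (≤-reflexive (sym (∑-+ xs _ _))) (∑-mono xs (λ {x} _ → pointwise (P? x) (Q? x) (R? x) f g h))
  where
  pointwise : ∀ {P Q R : Set} (P? : Dec P) (Q? : Dec Q) (R? : Dec R) →
    (P → R) → (Q → R) → (P → ¬ Q) → 𝟙 P? + 𝟙 Q? ≤ 𝟙 R?
  pointwise (yes p) (yes q) _       f g h = contradiction q (h p)
  pointwise (yes p) (no _)  (yes _) f g h = ≤-refl
  pointwise (yes p) (no _)  (no ¬r) f g h = contradiction (f p) ¬r
  pointwise (no _)  (yes q) (yes _) f g h = ≤-refl
  pointwise (no _)  (yes q) (no ¬r) f g h = contradiction (g q) ¬r
  pointwise (no _)  (no _)  _       f g h = z≤n

#-cover : ∀ {A : Set} {P : X → Set} (P? : Decidable P) {R : A → X → Set} (R? : ∀ a → Decidable (R a))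
  (xs : List X) (as : List A) →
  (∀ {x} → x ∈ xs → P x → ∃[ a ] a ∈ as × R a x) → # P? xs ≤ ∑ as (λ a → # (R? a) xs)
#-cover P? R? xs as f = ≤-trans (∑-mono xs (λ x∈ → pointwise (P? _) (f x∈))) (≤-reflexive (∑-swap xs as _))
  where
  pointwise : ∀ {x} {P : Set} (P? : Dec P) → (P → ∃[ a ] a ∈ as × _) → 𝟙 P? ≤ ∑ as (λ a → 𝟙 (R? a x))
  pointwise (no _)  f = z≤n
  pointwise {x} (yes p) f with f p
  ... | a , a∈ , r = ≤-trans (≤-reflexive (sym (𝟙-yes (R? a x) r))) (∈⇒≤∑ (λ a → 𝟙 (R? a x)) a∈)

#>0⇒∃ : {P : X → Set} (P? : Decidable P) (xs : List X) → 0 < # P? xs → ∃[ x ] x ∈ xs × P x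
#>0⇒∃ P? (x ∷ xs) pos with P? x
... | yes p = x , here refl , p
... | no  _ with #>0⇒∃ P? xs pos
...   | y , y∈ , p = y , there y∈ , p

∃⇒#>0 : {P : X → Set} (P? : Decidable P) {xs : List X} {x : X} → x ∈ xs → P x → 0 < # P? xs
∃⇒#>0 P? {x = x} x∈ p = ≤-trans (≤-reflexive (sym (𝟙-yes (P? x) p))) (∈⇒≤∑ (λ x → 𝟙 (P? x)) x∈)

length-cartesianProductWith : ∀ {C : Set} (f : A → B → C) (xs : List A) (ys : List B) →
  length (cartesianProductWith f xs ys) ≡ length xs * length ys
length-cartesianProductWith f []       ys = refl
length-cartesianProductWith f (x ∷ xs) ys = trans (length-++ (map (f x) ys))
  (cong₂ _+_ (length-map (f x) ys) (length-cartesianProductWith f xs ys))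

everything? : Decidable {A = X} (λ _ → Unit)
everything? _ = yes tt

#everything? : ∀ (xs : List X) → # everything? xs ≡ length xs
#everything? xs = trans (∑-const xs 1) (*-identityʳ _)

-- Subfamilies are carried as decidable predicates over one fixed list. Successive restrictions then
-- only strengthen a predicate, sizes are counts, and a list is filtered only once, at the very end.
record DPred (X : Set) : Set₁ where
  constructor dpred
  field
    holds : X → Set
    dec   : Decidable holds
open DPred public

count : DPred X → List X → ℕ
count P = # (dec P)

-- Subsets, agreement of words, maximal cliques

allSubsets : ∀ n → List (Subset n)
allSubsets zero    = [] ∷ []
allSubsets (suc n) = map (inside ∷_) (allSubsets n) ++ map (outside ∷_) (allSubsets n)

∈-allSubsets : ∀ (S : Subset n) → S ∈ allSubsets n
∈-allSubsets []            = here refl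
∈-allSubsets (inside  ∷ S) = ∈-++⁺ˡ (∈-map⁺ (inside ∷_) (∈-allSubsets S))
∈-allSubsets (outside ∷ S) = ∈-++⁺ʳ (map (inside ∷_) (allSubsets _)) (∈-map⁺ (outside ∷_) (∈-allSubsets S))

length-allSubsets : ∀ n → length (allSubsets n) ≡ 2 ^ n
length-allSubsets zero    = refl
length-allSubsets (suc n) = trans (length-++ (map (inside ∷_) (allSubsets n)))
  (cong₂ _+_ (trans (length-map (inside ∷_) (allSubsets n)) (length-allSubsets n))
    (trans (trans (length-map (outside ∷_) (allSubsets n)) (length-allSubsets n)) (sym (+-identityʳ _))))

_≟ˢ_ : DecidableEquality (Subset n)
_≟ˢ_ = Vec.≡-dec Bool._≟_

∣S∣≡∣S∩T∣+∣S∩∁T∣ : ∀ (S T : Subset n) → ∣ S ∣ ≡ ∣ S ∩ T ∣ + ∣ S ∩ ∁ T ∣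
∣S∣≡∣S∩T∣+∣S∩∁T∣ []            []            = refl
∣S∣≡∣S∩T∣+∣S∩∁T∣ (outside ∷ S) (t ∷ T)       = ∣S∣≡∣S∩T∣+∣S∩∁T∣ S T
∣S∣≡∣S∩T∣+∣S∩∁T∣ (inside  ∷ S) (inside  ∷ T) = cong suc (∣S∣≡∣S∩T∣+∣S∩∁T∣ S T)
∣S∣≡∣S∩T∣+∣S∩∁T∣ (inside  ∷ S) (outside ∷ T) = trans (cong suc (∣S∣≡∣S∩T∣+∣S∩∁T∣ S T)) (sym (+-suc _ _))

∣S∩S∣≡∣S∣ : ∀ (S : Subset n) → ∣ S ∩ S ∣ ≡ ∣ S ∣
∣S∩S∣≡∣S∣ S = cong ∣_∣ (∩-idem S)

S⊆T⇒S∩T≡S : ∀ {S T : Subset n} → S ⊆ˢ T → S ∩ T ≡ S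
S⊆T⇒S∩T≡S {S = S} {T} S⊆T = ⊆ˢ-antisym (p∩q⊆p S T) (λ x∈ → ∈-∩⁺ (x∈ , S⊆T x∈))

-- Greedy from the tail: an element joins only if it is good with no member chosen so far, and
-- otherwise that member dominates it. Reflexivity lets a new member dominate itself.
maximalClique : {Good : X → X → Set} (good? : ∀ x y → Dec (Good x y)) → (∀ x → Good x x) → (xs : List X) →
  ∃[ 𝓒 ] 𝓒 ⊆ xs × AllPairs (λ x y → ¬ Good x y) 𝓒 × (∀ {x} → x ∈ xs → ∃[ c ] c ∈ 𝓒 × Good x c)
maximalClique good? refl′ []       = [] , [] , [] , λ ()
maximalClique {Good = Good} good? refl′ (x ∷ xs) with maximalClique good? refl′ xs
... | 𝓒 , 𝓒⊆xs , bad , dom with any? (good? x) 𝓒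
...   | yes some = 𝓒 , x ∷ʳ 𝓒⊆xs , bad , λ { (here refl) → find some ; (there y∈) → dom y∈ }
...   | no  none = x ∷ 𝓒 , refl ∷ 𝓒⊆xs , All.¬Any⇒All¬ 𝓒 none ∷ bad ,
    λ { (here refl) → x , here refl , refl′ x ; (there y∈) → let c , c∈ , g = dom y∈ in c , there c∈ , g }

-- Relative to `P`, so that the hypothesis passes to a stronger predicate without touching the
-- sublist.
NoClique : (X → X → Set) → ℕ → DPred X → List X → Set
NoClique Bad m P xs = ∀ 𝓒 → 𝓒 ⊆ xs → All (holds P) 𝓒 → AllPairs Bad 𝓒 → length 𝓒 < m

module Agreement {D : Set} (_≟_ : DecidableEquality D) where

  agree : ∀ {K} → (Fin K → D) → (Fin K → D) → Subset K
  agree u v = Vec.tabulate (λ l → does (u l ≟ v l))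

  ∈-agree⁺ : ∀ {K} (u v : Fin K → D) {l} → u l ≡ v l → l ∈ˢ agree u v
  ∈-agree⁺ u v {l} eq = Vec.lookup⇒[]= l _ (trans (Vec.lookup∘tabulate _ l) (dec-true (u l ≟ v l) eq))

  ∈-agree⁻ : ∀ {K} (u v : Fin K → D) {l} → l ∈ˢ agree u v → u l ≡ v l
  ∈-agree⁻ u v {l} l∈ with u l ≟ v l | trans (sym (Vec.lookup∘tabulate (λ l → does (u l ≟ v l)) l)) (Vec.[]=⇒lookup l∈)
  ... | yes eq | _ = eq
  ... | no _   | ()

  AllOrNone : ∀ {K} → Subset K → (Fin K → D) → (Fin K → D) → Set
  AllOrNone I u v = (∀ {l} → l ∈ˢ I → u l ≡ v l) ⊎ (∀ {l} → l ∈ˢ I → u l ≢ v l)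

  module _ (p : ℕ) where

    -- `U` collects the coordinates not yet resolved; only agreements there still have to be
    -- controlled.
    Good : ∀ {K} → Subset K → (Fin K → D) → (Fin K → D) → Set
    Good U u v = p ∣ ∣ agree u v ∩ U ∣

    good-refl : ∀ {K} {U : Subset K} → p ∣ ∣ U ∣ → ∀ u → Good U u u
    good-refl {U = U} p∣U u = subst (λ S → p ∣ ∣ S ∣) (sym eq) p∣U
      where
      eq : agree u u ∩ U ≡ U
      eq = ⊆ˢ-antisym (p∩q⊆q (agree u u) U) (λ l∈ → ∈-∩⁺ (∈-agree⁺ u u refl , l∈))

    module _ {K} {I U : Subset K} (I⊆U : I ⊆ˢ U) (p∣I : p ∣ ∣ I ∣) {u v : Fin K → D} (block : AllOrNone I u v) where
      private
        S : Subset K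
        S = agree u v

        split : ∣ S ∩ U ∣ ≡ ∣ (S ∩ U) ∩ I ∣ + ∣ S ∩ (U ∩ ∁ I) ∣
        split = trans (∣S∣≡∣S∩T∣+∣S∩∁T∣ (S ∩ U) I) (cong (λ T → ∣ (S ∩ U) ∩ I ∣ + ∣ T ∣) (∩-assoc S U (∁ I)))

        p∣block : AllOrNone I u v → p ∣ ∣ (S ∩ U) ∩ I ∣
        p∣block (inj₁ all) = subst (λ T → p ∣ ∣ T ∣) (sym eq) p∣I
          where
          eq : (S ∩ U) ∩ I ≡ I
          eq = ⊆ˢ-antisym (p∩q⊆q (S ∩ U) I) (λ l∈ → ∈-∩⁺ (∈-∩⁺ (∈-agree⁺ u v (all l∈) , I⊆U l∈) , l∈))
        p∣block (inj₂ none) = subst (p ∣_) (sym eq) (p ∣0)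
          where
          eq : ∣ (S ∩ U) ∩ I ∣ ≡ 0
          eq = trans (cong ∣_∣ {y = ⊥} (⊆ˢ-antisym
                 (λ l∈ → let l∈SU , l∈I = ∈-∩⁻ (S ∩ U) I l∈ in
                   contradiction (∈-agree⁻ u v (proj₁ (∈-∩⁻ S U l∈SU))) (none l∈I))
                 (λ l∈ → contradiction l∈ ∉⊥))) (∣⊥∣≡0 K)

      -- The agreements in `U` split into those in `I` and those in the rest. The first number is 0
      -- or the size of `I`, a multiple of `p` either way, so the block never affects divisibility.
      good-remove : Good U u v → Good (U ∩ ∁ I) u v
      good-remove good = ∣m+n∣m⇒∣n (subst (p ∣_) split good) (p∣block block)

      good-restore : Good (U ∩ ∁ I) u v → Good U u v
      good-restore good = subst (p ∣_) (sym split) (∣m∣n⇒∣m+n (p∣block block) good)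

-- Pigeonhole: a maximal clique of bad pairs has fewer than `m` members `c`, every `x` is good with
-- one of them, and `φ x c` takes at most `2 ^ K` values. It is applied with `φ` the set of
-- agreements, both to find blocks and to find the common trace.
popularGroup : ∀ {K} {Good : X → X → Set} (good? : ∀ x y → Dec (Good x y)) → (∀ x → Good x x) →
  (φ : X → X → Subset K) {m : ℕ} (Q : DPred X) (xs : List X) →
  NoClique (λ x y → ¬ Good x y) m Q xs → 0 < count Q xs →
  ∃[ c ] c ∈ xs × holds Q c × ∃[ I ] count Q xs ≤ m * 2 ^ K *
    # (λ x → dec Q x ×-dec good? x c ×-dec (φ x c ≟ˢ I)) xs
popularGroup {X = X} {K = K} {Good = Good} good? good-refl φ {m} Q xs noClique pos
  with maximalClique good? good-refl (filter (dec Q) xs)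
... | 𝓒 , 𝓒⊆ , bad , dom = c , proj₁ c∈xs×Qc , proj₂ c∈xs×Qc , I , bound
  where
  Group : X × Subset K → X → Set
  Group (c , I) x = holds Q x × Good x c × φ x c ≡ I
  group? : ∀ cI → Decidable (Group cI)
  group? (c , I) x = dec Q x ×-dec good? x c ×-dec (φ x c ≟ˢ I)
  candidates : List (X × Subset K)
  candidates = cartesianProduct 𝓒 (allSubsets K)
  covered : ∀ {x} → x ∈ xs → holds Q x → ∃[ cI ] cI ∈ candidates × Group cI x
  covered {x} x∈ q with dom (∈-filter⁺ (dec Q) x∈ q)
  ... | c , c∈ , g = (c , φ x c) , ∈-cartesianProduct⁺ c∈ (∈-allSubsets _) , q , g , refl
  inhabited : ∃[ cI ] cI ∈ candidates
  inhabited with #>0⇒∃ (dec Q) xs pos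
  ... | x , x∈ , q with covered x∈ q
  ...   | cI , cI∈ , _ = cI , cI∈
  size : X × Subset K → ℕ
  size cI = # (group? cI) xs
  popular : ∃[ cI ] cI ∈ candidates × ∑ candidates size ≤ length candidates * size cI
  popular = ∃-popular size (proj₂ inhabited)
  c : X
  c = proj₁ (proj₁ popular)
  I : Subset K
  I = proj₂ (proj₁ popular)
  c∈𝓒 : c ∈ 𝓒
  c∈𝓒 = proj₁ (∈-cartesianProduct⁻ 𝓒 (allSubsets K) (proj₁ (proj₂ popular)))
  c∈xs×Qc : c ∈ xs × holds Q c
  c∈xs×Qc = ∈-filter⁻ (dec Q) (Sublist.lookup 𝓒⊆ c∈𝓒)
  ∣𝓒∣<m : length 𝓒 < m
  ∣𝓒∣<m = noClique 𝓒 (⊆-trans 𝓒⊆ (filter-⊆ (dec Q) xs)) (All-resp-⊆ 𝓒⊆ (All.all-filter (dec Q) xs)) bad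
  bound : count Q xs ≤ m * 2 ^ K * size (c , I)
  bound = begin
    count Q xs                        ≤⟨ #-cover (dec Q) group? xs candidates covered ⟩
    ∑ candidates size                 ≤⟨ proj₂ (proj₂ popular) ⟩
    length candidates * size (c , I)  ≡⟨ cong (_* size (c , I)) (trans (length-cartesianProductWith _,_ 𝓒 (allSubsets K)) (cong (length 𝓒 *_) (length-allSubsets K))) ⟩
    length 𝓒 * 2 ^ K * size (c , I)   ≤⟨ *-monoˡ-≤ (size (c , I)) (*-monoˡ-≤ (2 ^ K) (<⇒≤ ∣𝓒∣<m)) ⟩
    m * 2 ^ K * size (c , I)          ∎
    where open ≤-Reasoning

-- Greedy resolution of a family of words into blocks

module Resolution {X D : Set} (_≟_ : DecidableEquality D) {K : ℕ} (w : X → Fin K → D)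
  (p : ℕ) (m : ℕ) (xs : List X) where

  open Agreement _≟_

  Clash : Subset K → X → X → Set
  Clash U x y = ¬ Good p U (w x) (w y)

  record Block (U I : Subset K) : Set where
    field
      nonempty : Nonempty I
      inner    : I ⊆ˢ U
      p∣size   : p ∣ ∣ I ∣
  open Block

  Agrees? : ∀ (I : Subset K) (c : X) → Decidable (λ y → ∀ l → l ∈ˢ I → w y l ≡ w c l)
  Agrees? I c y = Fin.all? (λ l → (l ∈ˢ? I) →-dec (w y l ≟ w c l))

  Avoids? : ∀ (I : Subset K) (c : X) → Decidable (λ y → ∀ l → l ∈ˢ I → w y l ≢ w c l)
  Avoids? I c y = Fin.all? (λ l → (l ∈ˢ? I) →-dec ¬? (w y l ≟ w c l))

  agreeing avoiding : Subset K → X → DPred X → DPred X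
  agreeing I c P = dpred _ (λ y → dec P y ×-dec Agrees? I c y)
  avoiding I c P = dpred _ (λ y → dec P y ×-dec Avoids? I c y)

  -- The factor `m * 2 ^ K` is the price of `popularGroup` inside one star; the factor `K` counts
  -- the stars deleted around a block, one per coordinate.
  lossOnce : ℕ
  lossOnce = K * (m * 2 ^ K)

  -- Its count is the degree of the letter that `x` carries at coordinate `i`.
  star : Fin K → X → DPred X → DPred X
  star i x P = dpred _ (λ y → dec P y ×-dec (w y i ≟ w x i))

  good? : ∀ U y z → Dec (Good p U (w y) (w z))
  good? U y z = p ∣? ∣ agree (w y) (w z) ∩ U ∣

  module _ {U : Subset K} (P : DPred X) {i : Fin K} {x : X}
    (maximal : ∀ {l y} → l ∈ˢ U → y ∈ xs → holds P y → count (star l y P) xs ≤ count (star i x P) xs) where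

    -- A word that does not avoid `c` on `I` lies in the star of some letter of `c` at a coordinate
    -- of `I`. There are at most `K` such stars, none larger than the maximal one.
    removed≤ : ∀ {I c} → I ⊆ˢ U → c ∈ xs → holds P c →
      count P xs ≤ count (avoiding I c P) xs + K * count (star i x P) xs
    removed≤ {I} {c} I⊆U c∈ pc =
      ≤-trans (#-⊎ (dec P) (dec (avoiding I c P)) meets? xs (λ _ → dichotomy)) (+-monoʳ-≤ (count (avoiding I c P) xs) #meets)
      where
      meets? : Decidable (λ y → holds P y × ∃[ l ] l ∈ˢ I × w y l ≡ w c l)
      meets? y = dec P y ×-dec Fin.any? (λ l → (l ∈ˢ? I) ×-dec (w y l ≟ w c l))
      meetsAt? : ∀ l → Decidable (λ y → holds P y × l ∈ˢ I × w y l ≡ w c l)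
      meetsAt? l y = dec P y ×-dec (l ∈ˢ? I) ×-dec (w y l ≟ w c l)
      #meetsAt : ∀ l → Dec (l ∈ˢ I) → # (meetsAt? l) xs ≤ count (star i x P) xs
      #meetsAt l (no l∉I) = ≤-trans (#-mono (meetsAt? l) (λ _ → no id) xs (λ _ (_ , l∈ , _) → l∉I l∈))
                              (≤-trans (≤-reflexive (∑-0 xs)) z≤n)
      #meetsAt l (yes l∈I) = ≤-trans (#-mono (meetsAt? l) (dec (star l c P)) xs (λ _ (py , _ , eq) → py , eq))
                               (maximal (I⊆U l∈I) c∈ pc)
      #meets : # meets? xs ≤ K * count (star i x P) xs
      #meets = begin
        # meets? xs                                ≤⟨ #-cover meets? meetsAt? xs (allFin K) (λ _ (py , l , rest) → l , ∈-allFin l , py , rest) ⟩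
        ∑ (allFin K) (λ l → # (meetsAt? l) xs)     ≤⟨ ∑≤length* (allFin K) (λ {l} _ → #meetsAt l (l ∈ˢ? I)) ⟩
        length (allFin K) * count (star i x P) xs  ≡⟨ cong (_* count (star i x P) xs) (length-tabulate {n = K} id) ⟩
        K * count (star i x P) xs                  ∎
        where open ≤-Reasoning
      dichotomy : ∀ {y} → holds P y → holds (avoiding I c P) y ⊎ (holds P y × ∃[ l ] l ∈ˢ I × w y l ≡ w c l)
      dichotomy {y} py with Fin.any? (λ l → (l ∈ˢ? I) ×-dec (w y l ≟ w c l))
      ... | yes meet = inj₂ (py , meet)
      ... | no ¬meet = inj₁ (py , λ l l∈ eq → ¬meet (l , l∈ , eq))

    module _ {I : Subset K} {c : X} where

      group? : Decidable (λ y → (holds P y × w y i ≡ w x i) × Good p U (w y) (w c) × agree (w y) (w c) ∩ U ≡ I)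
      group? y = dec (star i x P) y ×-dec good? U y c ×-dec ((agree (w y) (w c) ∩ U) ≟ˢ I)

      -- Any member `y` of the group certifies the block: it shares with `c` the letter of `x` at
      -- `i`, so `i` lies in `I`, and goodness of `y` and `c` makes the size of `I` a multiple of
      -- `p`.
      group-block : i ∈ˢ U → w c i ≡ w x i → 0 < # group? xs → Block U I
      group-block i∈U ci group>0 with #>0⇒∃ group? xs group>0
      ... | y , _ , (_ , yi) , good , eq = record
        { nonempty = i , subst (i ∈ˢ_) eq (∈-∩⁺ (∈-agree⁺ (w y) (w c) (trans yi (sym ci)) , i∈U))
        ; inner    = λ l∈ → proj₂ (∈-∩⁻ (agree (w y) (w c)) U (subst (_ ∈ˢ_) (sym eq) l∈))
        ; p∣size   = subst (λ S → p ∣ ∣ S ∣) eq good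
        }

      group≤agreeing : # group? xs ≤ count (agreeing I c P) xs
      group≤agreeing = #-mono group? (dec (agreeing I c P)) xs (λ { {y} _ ((py , _) , _ , eq) → py , λ l l∈ →
        ∈-agree⁻ (w y) (w c) (proj₁ (∈-∩⁻ (agree (w y) (w c)) U (subst (l ∈ˢ_) (sym eq) l∈))) })

      -- Deleting everything that meets the block costs at most K times the maximal degree,
      -- which the words through the block make up for.
      splitBlock : i ∈ˢ U → c ∈ xs → holds P c → w c i ≡ w x i → 0 < count (star i x P) xs →
        count (star i x P) xs ≤ m * 2 ^ K * # group? xs →
        Block U I × 0 < count (agreeing I c P) xs ×
          count P xs ≤ count (avoiding I c P) xs + lossOnce * count (agreeing I c P) xs
      splitBlock i∈U c∈ pc ci degree>0 degree≤ = block , ≤-trans group>0 group≤agreeing , bound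
        where
        group>0 : 0 < # group? xs
        group>0 = n≢0⇒n>0 (λ eq → <-irrefl (sym (*-zeroʳ (m * 2 ^ K)))
          (subst (λ t → 0 < m * 2 ^ K * t) eq (≤-trans degree>0 degree≤)))
        block : Block U I
        block = group-block i∈U ci group>0
        bound : count P xs ≤ count (avoiding I c P) xs + lossOnce * count (agreeing I c P) xs
        bound = begin
          count P xs
            ≤⟨ removed≤ (inner block) c∈ pc ⟩
          count (avoiding I c P) xs + K * count (star i x P) xs
            ≤⟨ +-monoʳ-≤ (count (avoiding I c P) xs) (*-monoʳ-≤ K (≤-trans degree≤ (*-monoʳ-≤ (m * 2 ^ K) group≤agreeing))) ⟩
          count (avoiding I c P) xs + K * (m * 2 ^ K * count (agreeing I c P) xs)
            ≡⟨ cong (count (avoiding I c P) xs +_) (sym (*-assoc K (m * 2 ^ K) (count (agreeing I c P) xs))) ⟩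
          count (avoiding I c P) xs + lossOnce * count (agreeing I c P) xs
            ∎
          where open ≤-Reasoning

  candidates : Subset K → DPred X → List (Fin K × X)
  candidates U P = cartesianProduct (filter (_∈ˢ? U) (allFin K)) (filter (dec P) xs)

  ∈-candidates : ∀ {U P i x} → i ∈ˢ U → x ∈ xs → holds P x → (i , x) ∈ candidates U P
  ∈-candidates {U} {P} i∈U x∈ px = ∈-cartesianProduct⁺ (∈-filter⁺ (_∈ˢ? U) (∈-allFin _) i∈U) (∈-filter⁺ (dec P) x∈ px)

  maxDegree : ∀ {U} (P : DPred X) → Nonempty U → 0 < count P xs →
    ∃[ i ] ∃[ x ] i ∈ˢ U × x ∈ xs × holds P x ×
      (∀ {l y} → l ∈ˢ U → y ∈ xs → holds P y → count (star l y P) xs ≤ count (star i x P) xs)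
  maxDegree {U} P (i₀ , i₀∈U) pos with #>0⇒∃ (dec P) xs pos
  ... | x₀ , x₀∈ , px₀ with ∃-max (λ (i , x) → count (star i x P) xs) (∈-candidates {U} {P} i₀∈U x₀∈ px₀)
  ... | (i , x) , ix∈ , max with ∈-cartesianProduct⁻ _ (filter (dec P) xs) ix∈
  ...   | i∈ , x∈ with ∈-filter⁻ (_∈ˢ? U) {xs = allFin K} i∈ | ∈-filter⁻ (dec P) {xs = xs} x∈
  ...     | _ , i∈U | x∈xs , px = i , x , i∈U , x∈xs , px , λ l∈U y∈ py → max (∈-candidates {U} {P} l∈U y∈ py)

  -- The pigeonhole is applied inside the heaviest star and not to all of `P`: this forces `i` into
  -- `I`, so the block is nonempty, and makes the group comparable with every star that gets
  -- deleted.
  splitOff : ∀ {U} (P : DPred X) → p ∣ ∣ U ∣ → Nonempty U → NoClique (Clash U) m P xs → 0 < count P xs →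
    ∃[ I ] ∃[ c ] Block U I × 0 < count (agreeing I c P) xs ×
      count P xs ≤ count (avoiding I c P) xs + lossOnce * count (agreeing I c P) xs
  splitOff {U} P p∣U ne noClique pos with maxDegree P ne pos
  ... | i , x , i∈U , x∈ , px , max
    with ∃⇒#>0 (dec (star i x P)) x∈ (px , refl)
  ... | degree>0
    with popularGroup (good? U) (λ y → good-refl p p∣U (w y)) (λ y z → agree (w y) (w z) ∩ U) (star i x P) xs
           (λ 𝓒 𝓒⊆ all → noClique 𝓒 𝓒⊆ (All.map proj₁ all)) degree>0
  ... | c , c∈ , (pc , ci) , I , degree≤ = I , c , splitBlock P max i∈U c∈ pc ci degree>0 degree≤

  -- Blocks with the same coordinate set are merged into one cluster, whatever letters they carry.
  -- There are then at most `2 ^ K` clusters to choose from, and inside one of them two words agree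
  -- everywhere or nowhere on `I`.
  record Clustering (U : Subset K) (P : DPred X) : Set₁ where
    field
      cluster : Subset K → DPred X
      within  : ∀ {I x} → holds (cluster I) x → holds P x
      valid   : ∀ {I x} → holds (cluster I) x → Block U I
      uniform : ∀ {I x y} → holds (cluster I) x → holds (cluster I) y → AllOrNone I (w x) (w y)
      large   : count P xs ≤ lossOnce * ∑ (allSubsets K) (λ I → count (cluster I) xs)

  module _ {U I : Subset K} {c : X} {P : DPred X} (block : Block U I) (rest : Clustering U (avoiding I c P)) where
    open Clustering rest

    private
      new? : ∀ J → Decidable (λ y → J ≡ I × holds (agreeing I c P) y)
      new? J y = (J ≟ˢ I) ×-dec dec (agreeing I c P) y

      merged? : ∀ J → Decidable (λ y → (J ≡ I × holds (agreeing I c P) y) ⊎ holds (cluster J) y)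
      merged? J y = new? J y ⊎-dec dec (cluster J) y

      all : List (Subset K)
      all = allSubsets K

      old new merged : Subset K → ℕ
      old J    = count (cluster J) xs
      new J    = # (new? J) xs
      merged J = # (merged? J) xs

      separate : ∀ {J y} → holds (cluster J) y → ¬ (J ≡ I × holds (agreeing I c P) y)
      separate h (refl , _ , y≡) = let l , l∈ = nonempty block in proj₂ (within h) l l∈ (y≡ l l∈)

      total : count P xs ≤ count (avoiding I c P) xs + lossOnce * count (agreeing I c P) xs →
        count P xs ≤ lossOnce * ∑ all merged
      total bound = begin
        count P xs
          ≤⟨ bound ⟩
        count (avoiding I c P) xs + lossOnce * count (agreeing I c P) xs
          ≤⟨ +-monoˡ-≤ _ large ⟩
        lossOnce * ∑ all old + lossOnce * count (agreeing I c P) xs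
          ≡⟨ sym (*-distribˡ-+ lossOnce _ _) ⟩
        lossOnce * (∑ all old + count (agreeing I c P) xs)
          ≤⟨ *-monoʳ-≤ lossOnce (+-monoʳ-≤ (∑ all old) (≤-trans
               (#-mono (dec (agreeing I c P)) (new? I) xs (λ _ g → refl , g))
               (∈⇒≤∑ new (∈-allSubsets I)))) ⟩
        lossOnce * (∑ all old + ∑ all new)
          ≡⟨ cong (lossOnce *_) (sym (∑-+ all old new)) ⟩
        lossOnce * ∑ all (λ J → old J + new J)
          ≤⟨ *-monoʳ-≤ lossOnce (∑-mono all (λ {J} _ →
               #-disjoint (dec (cluster J)) (new? J) (merged? J) xs inj₂ inj₁ separate)) ⟩
        lossOnce * ∑ all merged
          ∎
        where open ≤-Reasoning

    -- New words have the letters of `c` on `I`, while all remaining words avoid these letters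
    -- there. Hence a new and an old word of the same cluster agree nowhere on `I`, and no word is
    -- counted twice.
    addCluster : count P xs ≤ count (avoiding I c P) xs + lossOnce * count (agreeing I c P) xs → Clustering U P
    addCluster bound = record
      { cluster = λ J → dpred _ (merged? J)
      ; within  = λ { (inj₁ (_ , py , _)) → py ; (inj₂ y) → proj₁ (within y) }
      ; valid   = λ { (inj₁ (refl , _)) → block ; (inj₂ y) → valid y }
      ; uniform = λ
          { (inj₁ (refl , _ , x≡)) (inj₁ (_ , _ , y≡)) → inj₁ (λ l∈ → trans (x≡ _ l∈) (sym (y≡ _ l∈)))
          ; (inj₁ (refl , _ , x≡)) (inj₂ y) → inj₂ (λ l∈ e → proj₂ (within y) _ l∈ (trans (sym e) (x≡ _ l∈)))
          ; (inj₂ x) (inj₁ (refl , _ , y≡)) → inj₂ (λ l∈ e → proj₂ (within x) _ l∈ (trans e (y≡ _ l∈)))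
          ; (inj₂ x) (inj₂ y) → uniform x y }
      ; large   = total bound
      }

  module _ {U I : Subset K} {c : X} (P : DPred X) (block : Block U I) where

    agreeing+avoiding≤ : count (agreeing I c P) xs + count (avoiding I c P) xs ≤ count P xs
    agreeing+avoiding≤ = #-disjoint (dec (agreeing I c P)) (dec (avoiding I c P)) (dec P) xs proj₁ proj₁
      (λ a b → let l , l∈ = nonempty block in proj₂ b l l∈ (proj₂ a l l∈))

    avoiding-decreases : ∀ {n} → 0 < count (agreeing I c P) xs → count P xs ≤ suc n → count (avoiding I c P) xs ≤ n
    avoiding-decreases pos P≤ = ≤-pred (≤-trans (+-monoˡ-≤ (count (avoiding I c P) xs) pos) (≤-trans agreeing+avoiding≤ P≤))

  noClustering : ∀ {U} P → count P xs ≤ 0 → Clustering U P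
  noClustering P empty = record
    { cluster = λ _ → dpred (λ _ → Empty.⊥) (λ _ → no id)
    ; within = λ () ; valid = λ () ; uniform = λ () ; large = ≤-trans empty z≤n }

  -- Each block takes at least one word with it, so the words avoiding it are fewer and the bound
  -- `n` on their number can drop.
  clustering : ∀ n {U} (P : DPred X) → count P xs ≤ n → p ∣ ∣ U ∣ → Nonempty U →
    NoClique (Clash U) m P xs → Clustering U P
  clustering zero    P P≤n p∣U ne noClique = noClustering P P≤n
  clustering (suc n) {U} P P≤n p∣U ne noClique = continue (count P xs ≤? 0)
    where
    continue : Dec (count P xs ≤ 0) → Clustering U P
    continue (yes empty) = noClustering P empty
    continue (no more)   = let I , c , block , pos , bound = splitOff P p∣U ne noClique (≰⇒> more) in
      addCluster block (clustering n (avoiding I c P) (avoiding-decreases P block pos P≤n) p∣U ne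
        (λ 𝓒 𝓒⊆ all → noClique 𝓒 𝓒⊆ (All.map proj₁ all))) bound

  -- The extra `2 ^ K` pays for keeping only the most popular cluster.
  loss : ℕ
  loss = lossOnce * 2 ^ K

  record Resolved (U : Subset K) (P : DPred X) (n : ℕ) : Set₁ where
    field
      chosen   : DPred X
      chosen⊆  : ∀ {x} → holds chosen x → holds P x
      good     : ∀ {x y} → holds chosen x → holds chosen y → Good p U (w x) (w y)
      large    : count P xs ≤ n * count chosen xs

  block-nonZero : ∀ {U I} → Block U I → NonZero ∣ I ∣
  block-nonZero {I = I} block = let l , l∈ = nonempty block in >-nonZero (≤-trans (s≤s z≤n) (x∈p⇒∣p-x∣<∣p∣ l∈))

  ∣U∣≡∣I∣+∣U∖I∣ : ∀ {U I} → Block U I → ∣ U ∣ ≡ ∣ I ∣ + ∣ U ∩ ∁ I ∣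
  ∣U∣≡∣I∣+∣U∖I∣ {U} {I} block = trans (∣S∣≡∣S∩T∣+∣S∩∁T∣ U I)
    (cong (λ S → ∣ S ∣ + ∣ U ∩ ∁ I ∣) (trans (∩-comm U I) (S⊆T⇒S∩T≡S (inner block))))

  module _ {U I : Subset K} (block : Block U I) {P Q : DPred X} (Q⊆P : ∀ {x} → holds Q x → holds P x)
    (uniform : ∀ {x y} → holds Q x → holds Q y → AllOrNone I (w x) (w y)) where

    -- By the contrapositive of `good-remove`, a clash on the remaining coordinates is already a
    -- clash on `U`.
    noClique-remove : NoClique (Clash U) m P xs → NoClique (Clash (U ∩ ∁ I)) m Q xs
    noClique-remove noClique 𝓒 𝓒⊆ hs clashes = noClique 𝓒 𝓒⊆ (All.map Q⊆P hs) (restore hs clashes)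
      where
      restore : ∀ {𝓒} → All (holds Q) 𝓒 → AllPairs (Clash (U ∩ ∁ I)) 𝓒 → AllPairs (Clash U) 𝓒
      restore []       []         = []
      restore (h ∷ hs) (cl ∷ cls) =
        All.zipWith (λ (h′ , cl) g → cl (good-remove p (inner block) (p∣size block) (uniform h h′) g)) (hs , cl)
        ∷ restore hs cls

    resolved-restore : ∀ {n} → count P xs ≤ loss * count Q xs → Resolved (U ∩ ∁ I) Q n → Resolved U P (loss * n)
    resolved-restore {n} P≤ r = record
      { chosen  = chosen
      ; chosen⊆ = Q⊆P ∘ chosen⊆
      ; good    = λ hx hy → good-restore p (inner block) (p∣size block) (uniform (chosen⊆ hx) (chosen⊆ hy)) (good hx hy)
      ; large   = ≤-trans P≤ (≤-trans (*-monoʳ-≤ loss large) (≤-reflexive (sym (*-assoc loss n (count chosen xs)))))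
      }
      where open Resolved r

  popularCluster : ∀ {U P} (c : Clustering U P) → ∃[ I ] count P xs ≤ loss * count (Clustering.cluster c I) xs
  popularCluster {U} {P} c with ∃-popular (λ I → count (Clustering.cluster c I) xs) (∈-allSubsets U)
  ... | I , _ , popular = I , (begin
    count P xs                                                 ≤⟨ large ⟩
    lossOnce * ∑ (allSubsets K) (λ I → count (cluster I) xs)   ≤⟨ *-monoʳ-≤ lossOnce popular ⟩
    lossOnce * (length (allSubsets K) * count (cluster I) xs)  ≡⟨ cong (λ t → lossOnce * (t * count (cluster I) xs)) (length-allSubsets K) ⟩
    lossOnce * (2 ^ K * count (cluster I) xs)                  ≡⟨ sym (*-assoc lossOnce _ _) ⟩
    loss * count (cluster I) xs                                ∎)
    where
    open ≤-Reasoning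
    open Clustering c

  -- Induction on `j`: the block removed is nonempty of size divisible by `p`, so at least `p`
  -- coordinates disappear per round, at the cost of one factor `loss`. With no coordinates left
  -- there are 0 agreements.
  resolve : ∀ j {U} (P : DPred X) .{{_ : NonZero p}} .{{_ : NonZero loss}} → p ∣ ∣ U ∣ → ∣ U ∣ ≤ j * p →
    NoClique (Clash U) m P xs → Resolved U P (loss ^ j)
  resolve j {U} P p∣U U≤ noClique with nonempty? U
  ... | no empty = record
    { chosen = P ; chosen⊆ = id
    ; good = λ {x} {y} _ _ → subst (p ∣_) (sym (none x y)) (p ∣0)
    ; large = m≤n*m (count P xs) (loss ^ j) {{m^n≢0 loss j}} }
    where
    none : ∀ x y → ∣ agree (w x) (w y) ∩ U ∣ ≡ 0
    none x y = n≤0⇒n≡0 (≤-trans (∣p∩q∣≤∣q∣ (agree (w x) (w y)) U)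
      (≤-reflexive (trans (cong ∣_∣ (Empty-unique empty)) (∣⊥∣≡0 K))))
  resolve zero    P p∣U U≤ noClique | yes (l , l∈) = contradiction (≤-trans (x∈p⇒∣p-x∣<∣p∣ l∈) U≤) (λ ())
  resolve (suc j) P p∣U U≤ noClique | yes ne with clustering (count P xs) P ≤-refl p∣U ne noClique
  ... | c with popularCluster c
  ...   | I , P≤ with 0 <? count (Clustering.cluster c I) xs
  -- `valid` yields a block only from a member of the cluster. If the most popular cluster is empty,
  -- then so is `P`, and choosing nothing suffices.
  ...     | no empty = record
    { chosen = dpred (λ _ → Empty.⊥) (λ _ → no id) ; chosen⊆ = λ () ; good = λ ()
    ; large = ≤-trans P≤ (≤-trans (≤-reflexive (trans (cong (loss *_) (n≤0⇒n≡0 (≮⇒≥ empty))) (*-zeroʳ loss))) z≤n) }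
  ...     | yes pos with #>0⇒∃ (dec (Clustering.cluster c I)) xs pos
  ...       | x , _ , h = resolved-restore block within uniform P≤
    (resolve j (cluster I) (∣m+n∣m⇒∣n (subst (p ∣_) (∣U∣≡∣I∣+∣U∖I∣ block) p∣U) (p∣size block)) U′≤
      (noClique-remove block {P} {cluster I} within uniform noClique))
    where
    open Clustering c
    block = valid h
    U′≤ = +-cancelˡ-≤ p _ _ (≤-trans (+-monoˡ-≤ _ (∣⇒≤ {{block-nonZero block}} (p∣size block)))
            (≤-trans (≤-reflexive (sym (∣U∣≡∣I∣+∣U∖I∣ block))) U≤))

-- Passing to a k-partite subfamily

∣F∩G∣≡∣F∣⇒F∩G≡F : ∀ (F G : Subset n) → ∣ F ∩ G ∣ ≡ ∣ F ∣ → F ∩ G ≡ F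
∣F∩G∣≡∣F∣⇒F∩G≡F []            []            eq = refl
∣F∩G∣≡∣F∣⇒F∩G≡F (outside ∷ F) (y ∷ G)       eq = cong (outside ∷_) (∣F∩G∣≡∣F∣⇒F∩G≡F F G eq)
∣F∩G∣≡∣F∣⇒F∩G≡F (inside  ∷ F) (inside  ∷ G) eq = cong (inside ∷_) (∣F∩G∣≡∣F∣⇒F∩G≡F F G (suc-injective eq))
∣F∩G∣≡∣F∣⇒F∩G≡F (inside  ∷ F) (outside ∷ G) eq = contradiction (≤-trans (≤-reflexive (sym eq)) (∣p∩q∣≤∣p∣ F G)) (<-irrefl refl)

∣F∩G∣<∣F∣ : ∀ {F G : Subset n} → ∣ F ∣ ≡ ∣ G ∣ → F ≢ G → ∣ F ∩ G ∣ < ∣ F ∣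
∣F∩G∣<∣F∣ {F = F} {G} eq F≢G = ≤∧≢⇒< (∣p∩q∣≤∣p∣ F G) λ full → F≢G (trans (sym (∣F∩G∣≡∣F∣⇒F∩G≡F F G full))
  (trans (∩-comm F G) (∣F∩G∣≡∣F∣⇒F∩G≡F G F (trans (cong ∣_∣ (∩-comm G F)) (trans full eq)))))

∩-distribʳ-∩ : ∀ (F G C : Subset n) → (F ∩ G) ∩ C ≡ (F ∩ C) ∩ (G ∩ C)
∩-distribʳ-∩ []       []       []       = refl
∩-distribʳ-∩ (false ∷ F) (g ∷ G)     (c ∷ C)     = cong (false ∷_) (∩-distribʳ-∩ F G C)
∩-distribʳ-∩ (true ∷ F)  (g ∷ G)     (true ∷ C)  = cong (_ ∷_) (∩-distribʳ-∩ F G C)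
∩-distribʳ-∩ (true ∷ F)  (g ∷ G)     (false ∷ C) = cong₂ _∷_ (Bool.∧-zeroʳ g) (∩-distribʳ-∩ F G C)

∣++∣ : ∀ {a b} (S : Subset a) (T : Subset b) → ∣ S Vec.++ T ∣ ≡ ∣ S ∣ + ∣ T ∣
∣++∣ []          T = refl
∣++∣ (true  ∷ S) T = cong suc (∣++∣ S T)
∣++∣ (false ∷ S) T = ∣++∣ S T

++-∩ : ∀ {a b} (S S′ : Subset a) (T T′ : Subset b) → (S Vec.++ T) ∩ (S′ Vec.++ T′) ≡ (S ∩ S′) Vec.++ (T ∩ T′)
++-∩ []      []        T T′ = refl
++-∩ (_ ∷ S) (_ ∷ S′) T T′ = cong (_ ∷_) (++-∩ S S′ T T′)

tabulate-++ : ∀ {A : Set} a {b} (f : Fin (a + b) → A) →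
  Vec.tabulate f ≡ Vec.tabulate (λ i → f (i ↑ˡ b)) Vec.++ Vec.tabulate (λ i → f (a ↑ʳ i))
tabulate-++ zero    f = refl
tabulate-++ (suc a) f = cong (f zero ∷_) (tabulate-++ a (λ i → f (suc i)))

∑-allFin : ∀ {k} (f : Fin (suc k) → ℕ) → ∑ (allFin (suc k)) f ≡ f zero + ∑ (allFin k) (λ i → f (suc i))
∑-allFin f = cong (f zero +_) (trans (cong (λ t → ∑ t f) (sym (map-tabulate id suc))) (∑-map (allFin _) suc f))

∣does∷∣ : ∀ {P : Set} (P? : Dec P) (S : Subset n) → ∣ does P? ∷ S ∣ ≡ 𝟙 P? + ∣ S ∣
∣does∷∣ (yes _) S = refl
∣does∷∣ (no _)  S = refl

∣tabulate∣≡∑ : ∀ {k} {P : Fin k → Set} (P? : Decidable P) → ∣ Vec.tabulate (λ i → does (P? i)) ∣ ≡ ∑ (allFin k) (λ i → 𝟙 (P? i))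
∣tabulate∣≡∑ {zero}  P? = refl
∣tabulate∣≡∑ {suc k} P? = trans (∣does∷∣ (P? zero) (Vec.tabulate (λ i → does (P? (suc i)))))
  (trans (cong (𝟙 (P? zero) +_) (∣tabulate∣≡∑ (λ i → P? (suc i)))) (sym (∑-allFin (λ i → 𝟙 (P? i)))))

%-≡⇒∣∸ : ∀ x y p .{{_ : NonZero p}} → x % p ≡ y % p → p ∣ x ∸ y
%-≡⇒∣∸ x y p eq = divides (x / p ∸ y / p) (begin
  x ∸ y                                        ≡⟨ cong₂ _∸_ (m≡m%n+[m/n]*n x p) (m≡m%n+[m/n]*n y p) ⟩
  x % p + x / p * p ∸ (y % p + y / p * p)      ≡⟨ cong (λ t → t + x / p * p ∸ (y % p + y / p * p)) eq ⟩
  y % p + x / p * p ∸ (y % p + y / p * p)      ≡⟨ [m+n]∸[m+o]≡n∸o (y % p) (x / p * p) (y / p * p) ⟩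
  x / p * p ∸ y / p * p                        ≡⟨ sym (*-distribʳ-∸ p (x / p) (y / p)) ⟩
  (x / p ∸ y / p) * p                          ∎)
  where open ≡-Reasoning

-- From the last element to the first, the colours on the set are 0, 1, 2 and so on. Prescribing the
-- order, and not only distinctness, makes the condition recursive and its probability a plain power
-- of `k`.
Rainbow : Vec (Fin k) n → Subset n → Set
Rainbow []      []            = Unit
Rainbow (c ∷ χ) (outside ∷ F) = Rainbow χ F
Rainbow (c ∷ χ) (inside  ∷ F) = toℕ c ≡ ∣ F ∣ × Rainbow χ F

rainbow? : ∀ (χ : Vec (Fin k) n) (F : Subset n) → Dec (Rainbow χ F)
rainbow? []      []            = yes tt
rainbow? (c ∷ χ) (outside ∷ F) = rainbow? χ F
rainbow? (c ∷ χ) (inside  ∷ F) = (toℕ c ≟ ∣ F ∣) ×-dec rainbow? χ F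

-- The factor by which the conditional expectation for a set changes when the first point gets
-- colour `c`; by `∑-headFactor` its average over `c` is at least 1.
headFactor : ∀ {k} → Fin k → Subset (suc n) → ℕ
headFactor     c (outside ∷ F) = 1
headFactor {k = k} c (inside  ∷ F) = k * 𝟙 (toℕ c ≟ ∣ F ∣)

∑-headFactor : ∀ {k} (F : Subset (suc n)) → ∣ F ∣ ≤ k → k ≤ ∑ (allFin k) (λ c → headFactor c F)
∑-headFactor {k = k} (outside ∷ F) F≤ = ≤-reflexive (sym (trans (∑-const (allFin k) 1)
  (trans (cong (_* 1) (length-tabulate {n = k} id)) (*-identityʳ k))))
∑-headFactor {k = k} (inside ∷ F) F< = ≤-trans (≤-reflexive (sym (trans (cong (k *_)
    (𝟙-yes (toℕ (fromℕ< F<) ≟ ∣ F ∣) (toℕ-fromℕ< F<))) (*-identityʳ k))))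
  (∈⇒≤∑ (λ c → headFactor c (inside ∷ F)) (∈-allFin (fromℕ< F<)))

rainbow-∷ : ∀ {k} (c : Fin k) χ (F : Subset (suc n)) g →
  𝟙 (rainbow? χ (Vec.tail F)) * (k ^ ∣ Vec.tail F ∣ * (headFactor c F * g)) ≤ 𝟙 (rainbow? (c ∷ χ) F) * (k ^ ∣ F ∣ * g)
rainbow-∷ {k = k} c χ (outside ∷ F) g = ≤-reflexive (cong (λ t → 𝟙 (rainbow? χ F) * (k ^ ∣ F ∣ * t)) (+-identityʳ g))
rainbow-∷ {k = k} c χ (inside  ∷ F) g with toℕ c ≟ ∣ F ∣ | rainbow? χ F
... | yes _ | yes _ = ≤-reflexive (cong (1 *_) (trans (cong (λ t → k ^ ∣ F ∣ * (t * g)) (*-identityʳ k))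
                        (trans (sym (*-assoc (k ^ ∣ F ∣) k g)) (cong (_* g) (*-comm (k ^ ∣ F ∣) k)))))
... | yes _ | no _  = z≤n
... | no _  | yes _ = ≤-reflexive (trans (+-identityʳ _) (trans (cong (λ t → k ^ ∣ F ∣ * (t * g)) (*-zeroʳ k)) (*-zeroʳ (k ^ ∣ F ∣))))
... | no _  | no _  = z≤n

-- The method of conditional expectations: a set with s remaining elements is rainbow with probability k ^ (- s).
∃-rainbow : ∀ {k} .{{_ : NonZero k}} n (xs : List X) (F : X → Subset n) (g : X → ℕ) → (∀ {x} → x ∈ xs → ∣ F x ∣ ≤ k) →
  ∃[ χ ] ∑ xs g ≤ ∑ xs (λ x → 𝟙 (rainbow? {k} χ (F x)) * (k ^ ∣ F x ∣ * g x))
∃-rainbow {k = k} zero xs F g F≤ = [] , ∑-mono xs (λ {x} _ → trivial (F x) (g x))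
  where
  trivial : ∀ F g → g ≤ 𝟙 (rainbow? {k} [] F) * (k ^ ∣ F ∣ * g)
  trivial [] g = ≤-reflexive (sym (trans (+-identityʳ _) (+-identityʳ g)))
∃-rainbow {X = X} {k = k} (suc n) xs F g F≤ =
  -- The weights `g` record the colours fixed so far. The best colour for the first point does at
  -- least as well as the average, and the tail inherits the updated weights.
  let c , _ , popular = ∃-popular weight (∈-allFin (fromℕ< (>-nonZero⁻¹ k)))
      χ , bound = ∃-rainbow n xs (λ x → Vec.tail (F x)) (λ x → headFactor c (F x) * g x)
        (λ {x} x∈ → ≤-trans (∣tail∣≤ (F x)) (F≤ x∈))
  in c ∷ χ , ≤-trans (*-cancelˡ-≤ k (≤-trans average (≤-trans popular (≤-reflexive (cong (_* weight c) (length-tabulate {n = k} id))))))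
       (≤-trans bound (∑-mono xs (λ {x} _ → rainbow-∷ c χ (F x) (g x))))
  where
  weight : Fin k → ℕ
  weight c = ∑ xs (λ x → headFactor c (F x) * g x)
  ∣tail∣≤ : ∀ (F : Subset (suc n)) → ∣ Vec.tail F ∣ ≤ ∣ F ∣
  ∣tail∣≤ (x ∷ F) = ∣p∣≤∣x∷p∣ x F
  average : k * ∑ xs g ≤ ∑ (allFin k) weight
  average = begin
    k * ∑ xs g                                                 ≡⟨ sym (∑-*ˡ xs k g) ⟩
    ∑ xs (λ x → k * g x)                                       ≤⟨ ∑-mono xs (λ {x} x∈ → *-monoˡ-≤ (g x) (∑-headFactor (F x) (F≤ x∈))) ⟩
    ∑ xs (λ x → ∑ (allFin k) (λ c → headFactor c (F x)) * g x)     ≡⟨ ∑-cong xs (λ x → sym (∑-*ʳ (allFin k) (g x) (λ c → headFactor c (F x)))) ⟩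
    ∑ xs (λ x → ∑ (allFin k) (λ c → headFactor c (F x) * g x))     ≡⟨ ∑-swap xs (allFin k) (λ x c → headFactor c (F x) * g x) ⟩
    ∑ (allFin k) weight                                        ∎
    where open ≤-Reasoning

colourClass : Vec (Fin k) n → Fin k → Subset n
colourClass χ i = Vec.map (λ c → does (c Fin.≟ i)) χ

∑-𝟙-≟ : ∀ {k} (c : Fin k) → ∑ (allFin k) (λ i → 𝟙 (c Fin.≟ i)) ≡ 1
∑-𝟙-≟ {suc k} zero    = trans (∑-allFin {k} (λ i → 𝟙 (zero Fin.≟ i))) (cong suc (trans
  (∑-cong (allFin k) (λ i → 𝟙-no (zero {k} Fin.≟ suc i) (λ ()))) (∑-0 (allFin k))))
∑-𝟙-≟ {suc k} (suc c) = trans (∑-allFin (λ i → 𝟙 (suc c Fin.≟ i))) (trans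
  (∑-cong (allFin k) (λ i → 𝟙-cong (suc c Fin.≟ suc i) (c Fin.≟ i) Fin.suc-injective (cong suc))) (∑-𝟙-≟ c))

∑∣S∩colourClass∣ : ∀ (χ : Vec (Fin k) n) (S : Subset n) → ∑ (allFin k) (λ i → ∣ S ∩ colourClass χ i ∣) ≡ ∣ S ∣
∑∣S∩colourClass∣ {k} []  []            = ∑-0 (allFin k)
∑∣S∩colourClass∣ (c ∷ χ) (outside ∷ S) = ∑∣S∩colourClass∣ χ S
∑∣S∩colourClass∣ (c ∷ χ) (inside  ∷ S) = trans (∑-cong (allFin _) (λ i → ∣does∷∣ (c Fin.≟ i) (S ∩ colourClass χ i)))
  (trans (∑-+ (allFin _) (λ i → 𝟙 (c Fin.≟ i)) (λ i → ∣ S ∩ colourClass χ i ∣)) (cong₂ _+_ (∑-𝟙-≟ c) (∑∣S∩colourClass∣ χ S)))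

-- Gives uniqueness in `rainbow-below`: behind an element of colour `i` there are exactly `i`
-- further elements, so that colour cannot recur.
rainbow-above : ∀ (χ : Vec (Fin k) n) F → Rainbow χ F → ∀ {i} → ∣ F ∣ ≤ toℕ i → ∣ F ∩ colourClass χ i ∣ ≡ 0
rainbow-above []      []            _        F≤i = refl
rainbow-above (c ∷ χ) (outside ∷ F) r        F≤i = rainbow-above χ F r F≤i
rainbow-above (c ∷ χ) (inside  ∷ F) (c≡ , r) {i} F<i with c Fin.≟ i
... | yes refl = contradiction (≤-trans F<i (≤-reflexive c≡)) (<-irrefl refl)
... | no _     = rainbow-above χ F r (<⇒≤ F<i)

rainbow-below : ∀ (χ : Vec (Fin k) n) F → Rainbow χ F → ∀ {i} → toℕ i < ∣ F ∣ → ∣ F ∩ colourClass χ i ∣ ≡ 1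
rainbow-below (c ∷ χ) (outside ∷ F) r        i<F = rainbow-below χ F r i<F
rainbow-below (c ∷ χ) (inside  ∷ F) (c≡ , r) {i} i<F with c Fin.≟ i
... | yes refl = cong suc (rainbow-above χ F r (≤-reflexive (sym c≡)))
... | no c≢i   = rainbow-below χ F r (≤∧≢⇒< (≤-pred i<F) (λ eq → c≢i (toℕ-injective (trans c≡ (sym eq)))))

module Parts {k n : ℕ} (χ : Vec (Fin k) n) where

  open Agreement {Subset n} _≟ˢ_ public

  -- The letter at `i` is the element of colour `i`, kept as a subset so that the word is defined
  -- for every `F`. It is a singleton when `F` is a rainbow set of size `k`.
  parts : Subset n → Fin k → Subset n
  parts F i = F ∩ colourClass χ i

  -- Padding with k coordinates equal to F itself, on which distinct sets disagree,
  -- allows a set of coordinates to be completed to one whose size is a multiple of p.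
  word : Subset n → Fin (k + k) → Subset n
  word F l = [ parts F , (λ _ → F) ]′ (splitAt k l)

  -- Split the intersection by colour: within one colour class both sets are singletons, which meet
  -- exactly when they coincide.
  ∣F∩G∣≡∣agree∣ : ∀ {F G} → ∣ F ∣ ≡ k → ∣ G ∣ ≡ k → Rainbow χ F → Rainbow χ G → ∣ F ∩ G ∣ ≡ ∣ agree (parts F) (parts G) ∣
  ∣F∩G∣≡∣agree∣ {F} {G} ∣F∣ ∣G∣ rF rG = begin
    ∣ F ∩ G ∣                                            ≡⟨ sym (∑∣S∩colourClass∣ χ (F ∩ G)) ⟩
    ∑ (allFin k) (λ i → ∣ (F ∩ G) ∩ colourClass χ i ∣)   ≡⟨ ∑-cong (allFin k) pointwise ⟩
    ∑ (allFin k) (λ i → 𝟙 (parts F i ≟ˢ parts G i))      ≡⟨ sym (∣tabulate∣≡∑ (λ i → parts F i ≟ˢ parts G i)) ⟩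
    ∣ agree (parts F) (parts G) ∣                        ∎
    where
    open ≡-Reasoning
    one : ∀ {F} → ∣ F ∣ ≡ k → Rainbow χ F → ∀ i → ∣ parts F i ∣ ≡ 1
    one ∣F∣ rF i = rainbow-below χ _ rF (≤-trans (toℕ<n i) (≤-reflexive (sym ∣F∣)))
    pointwise : ∀ i → ∣ (F ∩ G) ∩ colourClass χ i ∣ ≡ 𝟙 (parts F i ≟ˢ parts G i)
    pointwise i with parts F i ≟ˢ parts G i
    ... | yes eq = trans (cong ∣_∣ (trans (∩-distribʳ-∩ F G _) (cong (parts F i ∩_) (sym eq)))) (trans (∣S∩S∣≡∣S∣ (parts F i)) (one ∣F∣ rF i))
    ... | no neq = trans (cong ∣_∣ (∩-distribʳ-∩ F G _)) (n≤0⇒n≡0 (≤-pred (≤-trans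
      (∣F∩G∣<∣F∣ (trans (one ∣F∣ rF i) (sym (one ∣G∣ rG i))) neq) (≤-reflexive (one ∣F∣ rF i)))))

  agree-word : ∀ {F G} → F ≢ G → ∀ S T → ∣ agree (word F) (word G) ∩ (S Vec.++ T) ∣ ≡ ∣ agree (parts F) (parts G) ∩ S ∣
  agree-word {F} {G} F≢G S T = begin
    ∣ agree (word F) (word G) ∩ (S Vec.++ T) ∣            ≡⟨ cong (λ A → ∣ A ∩ (S Vec.++ T) ∣) split ⟩
    ∣ (agree (parts F) (parts G) Vec.++ ⊥) ∩ (S Vec.++ T) ∣    ≡⟨ cong ∣_∣ (++-∩ (agree (parts F) (parts G)) S ⊥ T) ⟩
    ∣ (agree (parts F) (parts G) ∩ S) Vec.++ (⊥ ∩ T) ∣    ≡⟨ ∣++∣ (agree (parts F) (parts G) ∩ S) (⊥ ∩ T) ⟩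
    ∣ agree (parts F) (parts G) ∩ S ∣ + ∣ ⊥ ∩ T ∣         ≡⟨ cong (∣ agree (parts F) (parts G) ∩ S ∣ +_) (trans (cong ∣_∣ (∩-zeroˡ T)) (∣⊥∣≡0 k)) ⟩
    ∣ agree (parts F) (parts G) ∩ S ∣ + 0                 ≡⟨ +-identityʳ _ ⟩
    ∣ agree (parts F) (parts G) ∩ S ∣                     ∎
    where
    open ≡-Reasoning
    split : agree (word F) (word G) ≡ agree (parts F) (parts G) Vec.++ ⊥
    split = trans (tabulate-++ k _) (cong₂ Vec._++_
      (Vec.tabulate-cong (λ i → cong₂ (λ a b → does (a ≟ˢ b)) (cong [ parts F , (λ _ → F) ]′ (splitAt-↑ˡ k i k)) (cong [ parts G , (λ _ → G) ]′ (splitAt-↑ˡ k i k))))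
      (trans (Vec.tabulate-cong (λ i → trans
          (cong₂ (λ a b → does (a ≟ˢ b)) (cong [ parts F , (λ _ → F) ]′ (splitAt-↑ʳ k k i)) (cong [ parts G , (λ _ → G) ]′ (splitAt-↑ʳ k k i)))
          (dec-false (F ≟ˢ G) F≢G)))
        (const k)))
      where
      const : ∀ j → Vec.tabulate {n = j} (λ _ → false) ≡ ⊥
      const zero    = refl
      const (suc j) = cong (false ∷_) (const j)

-- The lower bounds

allPairs-upgrade : ∀ {X : Set} {P : X → Set} {R S : X → X → Set} {xs : List X} → All P xs → AllPairs R xs →
  (∀ {x y} → P x → P y → R x y → S x y) → AllPairs S xs
allPairs-upgrade []       []         f = []
allPairs-upgrade (p ∷ ps) (rs ∷ rss) f = All.zipWith (λ (q , r) → f p q r) (ps , rs) ∷ allPairs-upgrade ps rss f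

^-distribʳ-* : ∀ a b n → (a * b) ^ n ≡ a ^ n * b ^ n
^-distribʳ-* a b zero    = refl
^-distribʳ-* a b (suc n) = trans (cong (a * b *_) (^-distribʳ-* a b n)) ([m*n]*[o*p]≡[m*o]*[n*p] a b (a ^ n) (b ^ n))

-- The loss of one round for words of length `k + k`, with the factor `m` taken out.
baseLoss : ℕ → ℕ
baseLoss k = (k + k) * 2 ^ (k + k) * 2 ^ (k + k)

-- The three factors pay for the rainbow colouring, for the choice of the common trace, and for at
-- most `k` rounds of resolution.
totalLoss : ℕ → ℕ
totalLoss k = k ^ k * (2 ^ k * baseLoss k ^ k)

subsetOfSize : ∀ {n t} → t ≤ n → ∃[ T ] ∣_∣ {n} T ≡ t
subsetOfSize {n}     {zero}  _       = ⊥ , ∣⊥∣≡0 n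
subsetOfSize {suc n} {suc t} (s≤s t≤n) = let T , eq = subsetOfSize t≤n in inside ∷ T , cong suc eq

-- Rounds `s` up to a multiple of `p`. Fewer than `p` extra coordinates are needed, so `p ≤ k`
-- ensures that the `k` padding coordinates are enough.
padding : ∀ {p k s} .{{_ : NonZero p}} → p ≤ k → s ≤ k →
  ∃[ t ] Σ[ T ∈ Subset k ] ∣ T ∣ ≡ t × p ∣ s + t × s + t ≤ (k + (p ∸ 1)) / p * p
padding {p@(suc p′)} {k} {s} p≤k s≤k = t , proj₁ T , proj₂ T , divides q s+t≡ ,
  ≤-trans (≤-reflexive s+t≡) (*-monoˡ-≤ p (/-monoˡ-≤ p (+-monoˡ-≤ p′ s≤k)))
  where
  q = (s + p′) / p
  t = q * p ∸ s
  division : s + p′ ≡ (s + p′) % p + q * p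
  division = m≡m%n+[m/n]*n (s + p′) p
  s≤qp : s ≤ q * p
  s≤qp = +-cancelʳ-≤ p′ s (q * p) (≤-trans (≤-reflexive division)
    (≤-trans (+-monoˡ-≤ (q * p) (≤-pred (m%n<n (s + p′) p))) (≤-reflexive (+-comm p′ (q * p)))))
  s+t≡ : s + t ≡ q * p
  s+t≡ = m+[n∸m]≡n s≤qp
  t≤p′ : t ≤ p′
  t≤p′ = m≤n+o⇒m∸n≤o (q * p) s (≤-trans (m≤n+m (q * p) _) (≤-reflexive (sym division)))
  T : ∃[ T ] ∣_∣ {k} T ≡ t
  T = subsetOfSize (≤-trans t≤p′ (≤-trans (n≤1+n p′) p≤k))

module LowerBound {k p m n : ℕ} .{{_ : NonZero k}} .{{_ : NonZero p}} .{{_ : NonZero m}}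
  {InL : ℕ → Set} {r : ℕ} (inL : ∀ ℓ → ℓ < k → ℓ % p ≢ r → InL ℓ) (notInL : ∀ ℓ → ℓ % p ≡ r → ¬ InL ℓ)
  {𝓕 : List (Subset n)} (system : IsKSystem k n 𝓕) (noClique : ¬ HasClique InL m 𝓕) where

  record Avoiding (P : DPred (Subset n)) (N : ℕ) : Set where
    field
      subfamily : List (Subset n)
      sublist   : subfamily ⊆ 𝓕
      avoids    : Avoids InL subfamily
      large     : count P 𝓕 ≤ N * length subfamily

  ClashOutsideL : Subset n → Subset n → Set
  ClashOutsideL F G = F ≢ G × ∣ F ∩ G ∣ % p ≢ r

  -- Distinct sets of size `k` meet in fewer than `k` points, so a wrong residue does put the
  -- intersection size in `L`. Cliques have exactly `m` members by definition, hence the truncation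
  -- of longer ones.
  noClique⇒< : ∀ 𝓒 → 𝓒 ⊆ 𝓕 → AllPairs ClashOutsideL 𝓒 → length 𝓒 < m
  noClique⇒< 𝓒 𝓒⊆ clash = ≰⇒> λ m≤ → noClique (take m 𝓒 , ⊆-trans (take-⊆ m 𝓒) 𝓒⊆ ,
    trans (length-take m 𝓒) (m≤n⇒m⊓n≡m m≤) ,
    AllPairs.take⁺ m (allPairs-upgrade (All-resp-⊆ 𝓒⊆ (proj₂ system)) clash
      (λ ∣F∣ ∣G∣ (F≢G , res) → inL _ (≤-trans (∣F∩G∣<∣F∣ (trans ∣F∣ (sym ∣G∣)) F≢G) (≤-reflexive ∣F∣)) res)))

  avoiding : ∀ {P N} (Y : DPred (Subset n)) →
    (∀ {F G} → holds Y F → holds Y G → F ≢ G → ∣ F ∩ G ∣ % p ≡ r) →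
    count P 𝓕 ≤ N * count Y 𝓕 → Avoiding P N
  avoiding {N = N} Y good P≤ = record
    { subfamily = filter (dec Y) 𝓕
    ; sublist   = filter-⊆ (dec Y) 𝓕
    ; avoids    = allPairs-upgrade (All.all-filter (dec Y) 𝓕) (AllPairs.filter⁺ (dec Y) (proj₁ system))
                    (λ hF hG F≢G → notInL _ (good hF hG F≢G))
    ; large     = ≤-trans P≤ (≤-reflexive (cong (N *_) (sym (length-filter≡# (dec Y) 𝓕))))
    }

  enlarge : ∀ {P Q N} M → count P 𝓕 ≤ M * count Q 𝓕 → Avoiding Q N → Avoiding P (M * N)
  enlarge {N = N} M P≤ A = record
    { subfamily = subfamily ; sublist = sublist ; avoids = avoids
    ; large = ≤-trans P≤ (≤-trans (*-monoʳ-≤ M large) (≤-reflexive (sym (*-assoc M N _)))) }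
    where open Avoiding A

  nothing : ∀ {P N} → count P 𝓕 ≤ 0 → Avoiding P N
  nothing P≤0 = record { subfamily = [] ; sublist = Sublist.minimum 𝓕 ; avoids = [] ; large = ≤-trans P≤0 z≤n }

  module _ (χ : Vec (Fin k) n) where
    open Parts χ
    open Resolution _≟ˢ_ word p m 𝓕 using (loss; Resolved; resolve; Clash)

    -- Once `a` common elements of the right residue are accounted for, an intersection size is
    -- allowed exactly when the agreements on `S` number a multiple of `p`. The padding `T` adds
    -- none between distinct sets.
    resolveRainbow : ∀ j {a} (P : DPred (Subset n)) (S T : Subset k) →
      (∀ {F G} → holds P F → holds P G → F ≢ G → a % p ≡ r × ∣ F ∩ G ∣ ≡ a + ∣ agree (parts F) (parts G) ∩ S ∣) →
      p ∣ ∣ S Vec.++ T ∣ → ∣ S Vec.++ T ∣ ≤ j * p → .{{_ : NonZero loss}} → Avoiding P (loss ^ j)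
    resolveRainbow j {a} P S T split p∣U U≤ = avoiding {P} (Resolved.chosen result)
      (λ hF hG F≢G → good⇒ (Resolved.chosen⊆ result hF) (Resolved.chosen⊆ result hG) F≢G (Resolved.good result hF hG))
      (Resolved.large result)
      where
      good⇒ : ∀ {F G} → holds P F → holds P G → F ≢ G → Good p (S Vec.++ T) (word F) (word G) → ∣ F ∩ G ∣ % p ≡ r
      good⇒ hF hG F≢G good with split hF hG F≢G
      ... | a≡r , eq = trans (cong (_% p) eq) (trans (%-remove-+ʳ a (subst (p ∣_) (agree-word F≢G S T) good)) a≡r)
      ⇒good : ∀ {F G} → holds P F → holds P G → F ≢ G → ∣ F ∩ G ∣ % p ≡ r → Good p (S Vec.++ T) (word F) (word G)
      ⇒good {F} {G} hF hG F≢G res with split hF hG F≢G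
      ... | a≡r , eq = subst (p ∣_) (trans (m+n∸m≡n a _) (sym (agree-word F≢G S T)))
        (%-≡⇒∣∸ (a + ∣ agree (parts F) (parts G) ∩ S ∣) a p (trans (cong (_% p) (sym eq)) (trans res (sym a≡r))))
      clash : ∀ {F G} → holds P F → holds P G → Clash (S Vec.++ T) F G → ClashOutsideL F G
      clash {F} hF hG bad = F≢G , λ res → bad (⇒good hF hG F≢G res)
        where
        F≢G = λ { refl → bad (good-refl p p∣U (word F)) }
      result : Resolved (S Vec.++ T) P (loss ^ j)
      result = resolve j P p∣U U≤ (λ 𝓒 𝓒⊆ hs clashes → noClique⇒< 𝓒 𝓒⊆ (allPairs-upgrade hs clashes clash))

    rainbowSets : DPred (Subset n)
    rainbowSets = dpred _ (λ F → (∣ F ∣ ≟ k) ×-dec rainbow? χ F)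

    ∣F∩G∣≡agree : ∀ {F G} → holds rainbowSets F → holds rainbowSets G → ∣ F ∩ G ∣ ≡ ∣ agree (parts F) (parts G) ∣
    ∣F∩G∣≡agree (∣F∣ , rF) (∣G∣ , rG) = ∣F∩G∣≡∣agree∣ ∣F∣ ∣G∣ rF rG

    avoidMultiples : ∀ j → 0 % p ≡ r → j * p ≡ k → .{{_ : NonZero loss}} → Avoiding rainbowSets (loss ^ j)
    avoidMultiples j 0≡r jp≡k = resolveRainbow j {0} rainbowSets ⊤ ⊥
      (λ {F} {G} hF hG F≢G → 0≡r , trans (∣F∩G∣≡agree hF hG) (cong ∣_∣ (sym (∩-identityʳ (agree (parts F) (parts G))))))
      (divides j size) (≤-reflexive size)
      where
      size : ∣ ⊤ {k} Vec.++ ⊥ {k} ∣ ≡ j * p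
      size = trans (∣++∣ (⊤ {k}) (⊥ {k})) (trans (cong₂ _+_ (∣⊤∣≡n k) (∣⊥∣≡0 k)) (trans (+-identityʳ k) (sym jp≡k)))

    -- Equality is added for reflexivity, since `k` itself need not have residue `r`.
    Near : Subset n → Subset n → Set
    Near F G = F ≡ G ⊎ ∣ F ∩ G ∣ % p ≡ r

    near? : ∀ F G → Dec (Near F G)
    near? F G = (F ≟ˢ G) ⊎-dec (∣ F ∩ G ∣ % p ≟ r)

    traceOn : Subset n → Subset k → DPred (Subset n)
    traceOn C A = dpred _ (λ F → dec rainbowSets F ×-dec near? F C ×-dec (agree (parts F) (parts C) ≟ˢ A))

    -- Both sets agree with `C` exactly on `A`, hence with each other there. The size of `A` has
    -- residue `r` because `F` and `G` are distinct, so at least one of them is not `C` and meets it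
    -- in residue `r`.
    trace-split : ∀ {C A F G} → holds rainbowSets C → holds (traceOn C A) F → holds (traceOn C A) G → F ≢ G →
      ∣ A ∣ % p ≡ r × ∣ F ∩ G ∣ ≡ ∣ A ∣ + ∣ agree (parts F) (parts G) ∩ ∁ A ∣
    trace-split {C} {A} {F} {G} hC (hF , nF , eqF) (hG , nG , eqG) F≢G = residue nF nG , (begin
      ∣ F ∩ G ∣                          ≡⟨ ∣F∩G∣≡agree hF hG ⟩
      ∣ S ∣                              ≡⟨ ∣S∣≡∣S∩T∣+∣S∩∁T∣ S A ⟩
      ∣ S ∩ A ∣ + ∣ S ∩ ∁ A ∣            ≡⟨ cong (λ B → ∣ B ∣ + ∣ S ∩ ∁ A ∣) (trans (∩-comm S A) (S⊆T⇒S∩T≡S A⊆S)) ⟩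
      ∣ A ∣ + ∣ S ∩ ∁ A ∣                ∎)
      where
      open ≡-Reasoning
      S = agree (parts F) (parts G)
      size : ∀ {H} → holds rainbowSets H → agree (parts H) (parts C) ≡ A → ∣ H ∩ C ∣ % p ≡ r → ∣ A ∣ % p ≡ r
      size hH eq res = trans (cong (_% p) (trans (cong ∣_∣ (sym eq)) (sym (∣F∩G∣≡agree hH hC)))) res
      residue : Near F C → Near G C → ∣ A ∣ % p ≡ r
      residue (inj₂ res) _           = size hF eqF res
      residue (inj₁ _)   (inj₂ res)  = size hG eqG res
      residue (inj₁ F≡C) (inj₁ G≡C)  = contradiction (trans F≡C (sym G≡C)) F≢G
      A⊆S : A ⊆ˢ S
      A⊆S l∈ = ∈-agree⁺ (parts F) (parts G) (trans
        (∈-agree⁻ (parts F) (parts C) (subst (_ ∈ˢ_) (sym eqF) l∈))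
        (sym (∈-agree⁻ (parts G) (parts C) (subst (_ ∈ˢ_) (sym eqG) l∈))))

    ¬near⇒clash : ∀ {F G} → ¬ Near F G → ClashOutsideL F G
    ¬near⇒clash ¬near = ¬near ∘ inj₁ , ¬near ∘ inj₂

    popularTrace : 0 < count rainbowSets 𝓕 →
      ∃[ C ] holds rainbowSets C × ∃[ A ] count rainbowSets 𝓕 ≤ m * 2 ^ k * count (traceOn C A) 𝓕
    popularTrace pos =
      let C , _ , hC , A , bound = popularGroup near? (λ _ → inj₁ refl) (λ F G → agree (parts F) (parts G)) rainbowSets 𝓕
                                     (λ 𝓒 𝓒⊆ _ bad → noClique⇒< 𝓒 𝓒⊆ (AllPairs.map ¬near⇒clash bad)) pos
      in C , hC , A , bound

    -- After passing to a popular trace `A`, the coordinates outside `A` are padded to a multiple of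
    -- `p` and resolved. The trace costs one factor `m`, the resolution at most one per `p`
    -- coordinates.
    avoidResidue : p ≤ k → .{{_ : NonZero loss}} → Avoiding rainbowSets (m * 2 ^ k * loss ^ ((k + (p ∸ 1)) / p))
    avoidResidue p≤k with 0 <? count rainbowSets 𝓕
    ... | no empty = nothing (≮⇒≥ empty)
    ... | yes pos  =
      let C , hC , A , bound = popularTrace pos
          t , T , ∣T∣≡t , p∣ , ≤j = padding p≤k (∣p∣≤n (∁ A))
          size = trans (∣++∣ (∁ A) T) (cong (∣ ∁ A ∣ +_) ∣T∣≡t)
      in enlarge {P = rainbowSets} {Q = traceOn C A} (m * 2 ^ k) bound (resolveRainbow ((k + (p ∸ 1)) / p) {∣ A ∣} (traceOn C A) (∁ A) T
           (trace-split hC) (subst (p ∣_) (sym size) p∣) (≤-trans (≤-reflexive size) ≤j))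

  everything : DPred (Subset n)
  everything = dpred _ everything?

  manyRainbow : ∃[ χ ] count everything 𝓕 ≤ k ^ k * count (rainbowSets χ) 𝓕
  manyRainbow =
    let χ , bound = ∃-rainbow n 𝓕 id (λ _ → 1) (λ F∈ → ≤-reflexive (size F∈))
    in χ , ≤-trans bound (≤-trans (∑-mono 𝓕 (λ {F} F∈ → pointwise χ F (size F∈))) (≤-reflexive (∑-*ˡ 𝓕 (k ^ k) _)))
    where
    size : ∀ {F} → F ∈ 𝓕 → ∣ F ∣ ≡ k
    size = All.lookup (proj₂ system)
    pointwise : ∀ χ F → ∣ F ∣ ≡ k → 𝟙 (rainbow? {k} χ F) * (k ^ ∣ F ∣ * 1) ≤ k ^ k * 𝟙 (dec (rainbowSets χ) F)
    pointwise χ F ∣F∣ = ≤-trans (*-mono-≤ (𝟙-mono (rainbow? χ F) (dec (rainbowSets χ) F) (∣F∣ ,_))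
        (≤-reflexive (trans (*-identityʳ _) (cong (k ^_) ∣F∣))))
      (≤-reflexive (*-comm (𝟙 (dec (rainbowSets χ) F)) (k ^ k)))

  length≡count : length 𝓕 ≡ count everything 𝓕
  length≡count = sym (#everything? 𝓕)

  -- Spelled out so as to agree by computation with the loss of `Resolution` at word length `k + k`,
  -- for every colouring.
  loss : ℕ
  loss = (k + k) * (m * 2 ^ (k + k)) * 2 ^ (k + k)

  loss≡ : loss ≡ baseLoss k * m
  loss≡ = begin
    (k + k) * (m * 2 ^ (k + k)) * 2 ^ (k + k)    ≡⟨ cong (λ t → (k + k) * t * 2 ^ (k + k)) (*-comm m (2 ^ (k + k))) ⟩
    (k + k) * (2 ^ (k + k) * m) * 2 ^ (k + k)    ≡⟨ cong (_* 2 ^ (k + k)) (sym (*-assoc (k + k) (2 ^ (k + k)) m)) ⟩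
    (k + k) * 2 ^ (k + k) * m * 2 ^ (k + k)      ≡⟨ *-assoc ((k + k) * 2 ^ (k + k)) m (2 ^ (k + k)) ⟩
    (k + k) * 2 ^ (k + k) * (m * 2 ^ (k + k))    ≡⟨ cong ((k + k) * 2 ^ (k + k) *_) (*-comm m (2 ^ (k + k))) ⟩
    (k + k) * 2 ^ (k + k) * (2 ^ (k + k) * m)    ≡⟨ sym (*-assoc ((k + k) * 2 ^ (k + k)) (2 ^ (k + k)) m) ⟩
    baseLoss k * m                               ∎
    where open ≡-Reasoning

  baseLoss-nonZero : NonZero (baseLoss k)
  baseLoss-nonZero = m*n≢0 ((k + k) * 2 ^ (k + k)) (2 ^ (k + k)) {{m*n≢0 (k + k) (2 ^ (k + k)) {{>-nonZero (≤-trans (>-nonZero⁻¹ k) (m≤m+n k k))}} {{m^n≢0 2 (k + k)}}}} {{m^n≢0 2 (k + k)}}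

  loss-nonZero : NonZero loss
  loss-nonZero = subst NonZero (sym loss≡) (m*n≢0 (baseLoss k) m {{baseLoss-nonZero}})

  loss^≤ : ∀ {j} → j ≤ k → loss ^ j ≤ baseLoss k ^ k * m ^ j
  loss^≤ {j} j≤k = ≤-trans (≤-reflexive (trans (cong (_^ j) loss≡) (^-distribʳ-* (baseLoss k) m j)))
    (*-monoˡ-≤ (m ^ j) (^-monoʳ-≤ (baseLoss k) {{baseLoss-nonZero}} j≤k))

  weaken : ∀ {P N N′} → N ≤ N′ → Avoiding P N → Avoiding P N′
  weaken N≤N′ A = record { subfamily = subfamily ; sublist = sublist ; avoids = avoids
                         ; large = ≤-trans large (*-monoˡ-≤ (length subfamily) N≤N′) }
    where open Avoiding A

  multiplesBound : ∀ j → 0 % p ≡ r → j * p ≡ k → Avoiding everything (totalLoss k * m ^ j)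
  multiplesBound j 0≡r jp≡k = let χ , bound = manyRainbow in
    weaken {everything} arithmetic (enlarge {everything} {rainbowSets χ} (k ^ k) bound
      (avoidMultiples χ j 0≡r jp≡k {{loss-nonZero}}))
    where
    base = baseLoss k ^ k
    j≤k : j ≤ k
    j≤k = ≤-trans (m≤m*n j p) (≤-reflexive jp≡k)
    arithmetic : k ^ k * loss ^ j ≤ totalLoss k * m ^ j
    arithmetic = begin
      k ^ k * loss ^ j                   ≤⟨ *-monoʳ-≤ (k ^ k) (loss^≤ j≤k) ⟩
      k ^ k * (base * m ^ j)                ≡⟨ sym (*-assoc (k ^ k) base (m ^ j)) ⟩
      k ^ k * base * m ^ j                  ≤⟨ *-monoˡ-≤ (m ^ j) (*-monoʳ-≤ (k ^ k) (m≤n*m base (2 ^ k) {{m^n≢0 2 k}})) ⟩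
      totalLoss k * m ^ j                ∎
      where open ≤-Reasoning

  residueBound : p ≤ k → Avoiding everything (totalLoss k * m ^ ((k + (p ∸ 1)) / p + 1))
  residueBound p≤k = let χ , bound = manyRainbow in
    weaken {everything} arithmetic (enlarge {everything} {rainbowSets χ} (k ^ k) bound
      (avoidResidue χ p≤k {{loss-nonZero}}))
    where
    base = baseLoss k ^ k
    j = (k + (p ∸ 1)) / p
    j≤k : j ≤ k
    j≤k = ≤-trans (/-monoˡ-≤ p ceiling) (≤-reflexive (m*n/n≡m k p))
      where
      ceiling : k + (p ∸ 1) ≤ k * p
      ceiling = ≤-trans (+-monoʳ-≤ k (m≤n*m (p ∸ 1) k)) (≤-reflexive (trans (sym (*-suc k (p ∸ 1)))
        (cong (k *_) (suc-pred p))))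
    arithmetic : k ^ k * (m * 2 ^ k * loss ^ j) ≤ totalLoss k * m ^ (j + 1)
    arithmetic = begin
      k ^ k * (m * 2 ^ k * loss ^ j)            ≤⟨ *-monoʳ-≤ (k ^ k) (*-monoʳ-≤ (m * 2 ^ k) (loss^≤ j≤k)) ⟩
      k ^ k * (m * 2 ^ k * (base * m ^ j))         ≡⟨ cong (k ^ k *_) (rearrange m (2 ^ k) base (m ^ j)) ⟩
      k ^ k * (2 ^ k * base * (m ^ j * m))         ≡⟨ sym (*-assoc (k ^ k) (2 ^ k * base) (m ^ j * m)) ⟩
      totalLoss k * (m ^ j * m)                 ≡⟨ cong (totalLoss k *_) (trans (*-comm (m ^ j) m) (cong (m ^_) (+-comm 1 j))) ⟩
      totalLoss k * m ^ (j + 1)                 ∎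
      where
      open ≤-Reasoning
      rearrange : ∀ a b c d → a * b * (c * d) ≡ b * c * (d * a)
      rearrange = solve-∀

-- Words with pairwise congruent agreements

partition≤ : ∀ {A X : Set} {R : A → X → Set} (R? : ∀ a → Decidable (R a)) (xs : List X) (as : List A) {b} →
  (∀ {x} → x ∈ xs → ∃[ a ] a ∈ as × R a x) → (∀ {a} → a ∈ as → length (filter (R? a) xs) ≤ b) →
  length xs ≤ length as * b
partition≤ R? xs as cover bound = ≤-trans (≤-reflexive (sym (#everything? xs)))
  (≤-trans (#-cover everything? R? xs as (λ x∈ _ → cover x∈))
    (∑≤length* as (λ {a} a∈ → ≤-trans (≤-reflexive (sym (length-filter≡# (R? a) xs))) (bound a∈))))

module IndependentSets {X : Set} {K n p : ℕ} .{{_ : NonZero n}} .{{_ : NonZero p}}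
  (w : X → Fin K → Fin n) (w-injective : ∀ {x y} → (∀ l → w x l ≡ w y l) → x ≡ y) where

  open Agreement {Fin n} Fin._≟_

  -- `A` need not contain all common coordinates, only those already exploited.
  record Congruent (A : Subset K) (xs : List X) : Set where
    field
      unique    : Unique xs
      congruent : ∀ {x y} → x ∈ xs → y ∈ xs → ∣ agree (w x) (w y) ∣ % p ≡ K % p
      common    : ∀ {x y l} → x ∈ xs → y ∈ xs → l ∈ˢ A → w x l ≡ w y l
  open Congruent

  congruent-filter : ∀ {A B xs} {P : X → Set} (P? : Decidable P) → Congruent A xs →
    (∀ {x y l} → x ∈ xs → P x → y ∈ xs → P y → l ∈ˢ B → w x l ≡ w y l) → Congruent B (filter P? xs)
  congruent-filter {xs = xs} P? c agr = record
    { unique    = Unique.filter⁺ P? (unique c)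
    ; congruent = λ x∈ y∈ → congruent c (proj₁ (∈-filter⁻ P? {xs = xs} x∈)) (proj₁ (∈-filter⁻ P? {xs = xs} y∈))
    ; common    = λ x∈ y∈ l∈ → let x∈ , px = ∈-filter⁻ P? x∈ ; y∈ , py = ∈-filter⁻ P? y∈ in agr x∈ px y∈ py l∈
    }

  full⇒≤1 : ∀ {A xs} → Congruent A xs → (∀ l → l ∈ˢ A) → length xs ≤ 1
  full⇒≤1 {xs = []}         c full = z≤n
  full⇒≤1 {xs = _ ∷ []}     c full = s≤s z≤n
  full⇒≤1 {xs = x ∷ y ∷ xs} c full with unique c
  ... | (x≢y ∷ _) ∷ _ = contradiction (w-injective (λ l → common c (here refl) (there (here refl)) (full l))) x≢y

  -- Sort the words by their agreement set `B` with a fixed word `x`. The number `K ∸ ∣ B ∣` is a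
  -- multiple of `p` and less than `suc t * p`, hence at most `t * p`; and the words of one class
  -- all agree on `B`.
  byAgreement : ∀ t {b A xs} → Congruent A xs → K < ∣ A ∣ + suc t * p →
    (∀ {B ys} → Congruent B ys → K ≤ ∣ B ∣ + t * p → length ys ≤ b) → length xs ≤ 2 ^ K * b
  byAgreement t {xs = []} c K< rec = z≤n
  byAgreement t {b} {A} {xs@(x ∷ _)} c K< rec =
    ≤-trans (partition≤ group? xs (allSubsets K) (λ {y} y∈ → agree (w x) (w y) , ∈-allSubsets _ , refl) (λ {B} _ → bound B))
      (≤-reflexive (cong (_* b) (length-allSubsets K)))
    where
    group? : ∀ B → Decidable (λ y → agree (w x) (w y) ≡ B)
    group? B y = agree (w x) (w y) ≟ˢ B
    large : ∀ {y} → y ∈ xs → K ≤ ∣ agree (w x) (w y) ∣ + t * p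
    large {y} y∈ with %-≡⇒∣∸ K ∣ agree (w x) (w y) ∣ p (sym (congruent c (here refl) y∈))
    ... | divides q eq = ≤-trans (≤-reflexive K≡) (+-monoʳ-≤ s (*-monoˡ-≤ p q≤t))
      where
      s = ∣ agree (w x) (w y) ∣
      K≡ : K ≡ s + q * p
      K≡ = trans (sym (m+[n∸m]≡n (∣p∣≤n (agree (w x) (w y))))) (cong (s +_) eq)
      A≤s : ∣ A ∣ ≤ s
      A≤s = p⊆q⇒∣p∣≤∣q∣ (λ l∈ → ∈-agree⁺ (w x) (w y) (common c (here refl) y∈ l∈))
      q≤t : q ≤ t
      q≤t = ≤-pred (*-cancelʳ-< p q (suc t) (+-cancelˡ-< s (q * p) (suc t * p)
        (≤-trans (≤-reflexive (cong suc (sym K≡))) (≤-trans K< (+-monoˡ-≤ (suc t * p) A≤s)))))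
    bound : ∀ B → length (filter (group? B) xs) ≤ b
    bound B with filter (group? B) xs in eq
    ... | []     = z≤n
    ... | y ∷ ys = subst (λ l → length l ≤ b) eq (rec {B}
      (congruent-filter (group? B) c (λ {u} {v} u∈ u≡ v∈ v≡ l∈ → trans
        (sym (∈-agree⁻ (w x) (w u) (subst (_ ∈ˢ_) (sym u≡) l∈)))
        (∈-agree⁻ (w x) (w v) (subst (_ ∈ˢ_) (sym v≡) l∈))))
      (let y∈ , y≡ = ∈-filter⁻ (group? B) {xs = xs} (subst (y ∈_) (sym eq) (here refl)) in
        subst (λ S → K ≤ ∣ S ∣ + t * p) y≡ (large y∈)))

  -- Each branching on the value of a new coordinate forces at least p further common coordinates.
  independent≤ : ∀ t {A xs} → Congruent A xs → K ≤ ∣ A ∣ + t * p → length xs ≤ (n * 2 ^ K) ^ t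
  independent≤ t {A} {xs} c K≤ with Fin.all? (λ l → l ∈ˢ? A)
  ... | yes full = ≤-trans (full⇒≤1 c full) (m^n>0 (n * 2 ^ K) {{m*n≢0 n (2 ^ K) {{it}} {{m^n≢0 2 K}}}} t)
  independent≤ zero {A} c K≤ | no ¬full = contradiction
    (λ l → subst (l ∈ˢ_) (sym (∣p∣≡n⇒p≡⊤ (≤-antisym (∣p∣≤n A) (≤-trans K≤ (≤-reflexive (+-identityʳ _)))))) ∈⊤) ¬full
  independent≤ (suc t) {A} {xs} c K≤ | no ¬full with Fin.¬∀⟶∃¬ K _ (_∈ˢ? A) ¬full
  ... | l , l∉A = ≤-trans
    (partition≤ (λ a y → w y l Fin.≟ a) xs (allFin n) (λ {y} _ → w y l , ∈-allFin _ , refl) (λ {a} _ →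
      -- The one extra common coordinate turns the weak inequality for `A` into the strict one
      -- required here; congruence then improves it by a full `p`.
      byAgreement t {A = A ∪ ⁅ l ⁆} (congruent-filter (λ y → w y l Fin.≟ a) c (common′ a))
        (≤-trans (s≤s K≤) (+-monoˡ-≤ (suc t * p) A<)) (independent≤ t)))
    (≤-reflexive (trans (cong (_* (2 ^ K * (n * 2 ^ K) ^ t)) (length-tabulate {n = n} id)) (sym (*-assoc n (2 ^ K) _))))
    where
    common′ : ∀ a {x y i} → x ∈ xs → w x l ≡ a → y ∈ xs → w y l ≡ a → i ∈ˢ A ∪ ⁅ l ⁆ → w x i ≡ w y i
    common′ a x∈ x≡ y∈ y≡ i∈ with x∈p∪q⁻ A ⁅ l ⁆ i∈
    ... | inj₁ i∈A = common c x∈ y∈ i∈A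
    ... | inj₂ i∈l = subst (λ i → w _ i ≡ w _ i) (sym (x∈⁅y⁆⇒x≡y l i∈l)) (trans x≡ (sym y≡))
    A< : ∣ A ∣ < ∣ A ∪ ⁅ l ⁆ ∣
    A< = p⊂q⇒∣p∣<∣q∣ (p⊆p∪q ⁅ l ⁆ , l , x∈p∪q⁺ (inj₂ (x∈⁅x⁆ l)) , l∉A)

  -- Starts with no common coordinate, where `K < suc (K / p) * p` already allows a first sorting by
  -- agreement.
  independentSet≤ : ∀ {xs} → Unique xs → (∀ {x y} → x ∈ xs → y ∈ xs → ∣ agree (w x) (w y) ∣ % p ≡ K % p) →
    length xs ≤ 2 ^ K * (n * 2 ^ K) ^ (K / p)
  independentSet≤ {xs} u cong′ = byAgreement (K / p) {A = ⊥}
    (record { unique = u ; congruent = cong′ ; common = λ _ _ l∈ → contradiction l∈ ∉⊥ })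
    (≤-trans K< (m≤n+m _ ∣ ⊥ {K} ∣)) (independent≤ (K / p))
    where
    K< : K < suc (K / p) * p
    K< = ≤-trans (≤-reflexive (cong suc (m≡m%n+[m/n]*n K p))) (+-monoˡ-≤ (K / p * p) (m%n<n K p))

-- The linear algebra bound

-- A matrix presented as a sum of rank-one matrices.
Terms : Set → Set
Terms X = List ((X → ℕ) × (X → ℕ))

⟦_⟧ : ∀ {X} → Terms X → X → X → ℕ
⟦ J ⟧ x y = ∑ J (λ (u , v) → u x * v y)

-- The entrywise product: rank-one terms multiply to rank-one terms, so the numbers of terms
-- multiply.
_⊛_ : ∀ {X} → Terms X → Terms X → Terms X
_⊛_ = cartesianProductWith (λ (u , v) (u′ , v′) → (λ x → u x * u′ x) , (λ y → v y * v′ y))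

⟦⊛⟧ : ∀ {X} (J J′ : Terms X) x y → ⟦ J ⊛ J′ ⟧ x y ≡ ⟦ J ⟧ x y * ⟦ J′ ⟧ x y
⟦⊛⟧ J J′ x y = trans (∑-cartesianProductWith _ J J′ _) (trans
  (∑-cong J (λ (u , v) → trans (∑-cong J′ (λ (u′ , v′) → [m*n]*[o*p]≡[m*o]*[n*p] (u x) (u′ x) (v y) (v′ y)))
    (∑-*ˡ J′ (u x * v y) _)))
  (∑-*ʳ J (⟦ J′ ⟧ x y) _))

∏Terms : ∀ {X} → (ℕ → Terms X) → ℕ → Terms X
∏Terms J zero    = ((λ _ → 1) , (λ _ → 1)) ∷ []
∏Terms J (suc l) = J (suc l) ⊛ ∏Terms J l

length-∏Terms : ∀ {X} (J : ℕ → Terms X) {d} → (∀ l → length (J l) ≡ d) → ∀ l → length (∏Terms J l) ≡ d ^ l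
length-∏Terms J len zero    = refl
length-∏Terms J len (suc l) = trans (length-cartesianProductWith _ (J (suc l)) (∏Terms J l))
  (cong₂ _*_ (len (suc l)) (length-∏Terms J len l))

funToFin-cong : ∀ M {p} {f g : Fin M → Fin p} → (∀ i → f i ≡ g i) → funToFin f ≡ funToFin g
funToFin-cong zero    f≗g = refl
funToFin-cong (suc M) f≗g = cong₂ combine (f≗g zero) (funToFin-cong M (λ i → f≗g (suc i)))

module _ {p : ℕ} (pr : Prime p) where
  private instance
    _ = prime⇒nonZero pr

  infix 4 _≈_
  _≈_ : ℕ → ℕ → Set
  a ≈ b = a % p ≡ b % p

  +-cong-≈ : ∀ {a b c d} → a ≈ b → c ≈ d → a + c ≈ b + d
  +-cong-≈ {a} {b} {c} {d} a≈b c≈d = trans (%-distribˡ-+ a c p)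
    (trans (cong₂ (λ s t → (s + t) % p) a≈b c≈d) (sym (%-distribˡ-+ b d p)))

  *-cong-≈ : ∀ {a b c d} → a ≈ b → c ≈ d → a * c ≈ b * d
  *-cong-≈ {a} {b} {c} {d} a≈b c≈d = trans (%-distribˡ-* a c p)
    (trans (cong₂ (λ s t → (s * t) % p) a≈b c≈d) (sym (%-distribˡ-* b d p)))

  ∑-cong-≈ : ∀ {A : Set} (xs : List A) {f g : A → ℕ} → (∀ {x} → x ∈ xs → f x ≈ g x) → ∑ xs f ≈ ∑ xs g
  ∑-cong-≈ []       f≈g = refl
  ∑-cong-≈ (x ∷ xs) {f} {g} f≈g = +-cong-≈ {f x} {g x} (f≈g (here refl)) (∑-cong-≈ xs (f≈g ∘ there))

  ∣⇒≈0 : ∀ {a} → p ∣ a → a ≈ 0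
  ∣⇒≈0 (divides q refl) = [m+kn]%n≡m%n 0 q p

  p∤∏ : ∀ {X} (J : ℕ → Terms X) l {x y} → (∀ i → 1 ≤ i → i ≤ l → ¬ p ∣ ⟦ J i ⟧ x y) → ¬ p ∣ ⟦ ∏Terms J l ⟧ x y
  p∤∏ J zero    h p∣1 = contradiction (∣1⇒≡1 p∣1) (λ { refl → nonTrivial⇒≢1 {{prime⇒nonTrivial pr}} refl })
  p∤∏ J (suc l) {x} {y} h p∣ with euclidsLemma (⟦ J (suc l) ⟧ x y) _ pr (subst (p ∣_) (⟦⊛⟧ (J (suc l)) (∏Terms J l) x y) p∣)
  ... | inj₁ d = h (suc l) (s≤s z≤n) ≤-refl d
  ... | inj₂ d = p∤∏ J l (λ i 1≤ i≤ → h i 1≤ (≤-trans i≤ (n≤1+n l))) d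

  p∣∏ : ∀ {X} (J : ℕ → Terms X) l {x y i} → 1 ≤ i → i ≤ l → p ∣ ⟦ J i ⟧ x y → p ∣ ⟦ ∏Terms J l ⟧ x y
  p∣∏ J zero    (s≤s _) () d
  p∣∏ J (suc l) {x} {y} {i} 1≤ i≤ d with i ≟ suc l
  ... | yes refl = subst (p ∣_) (sym (⟦⊛⟧ (J (suc l)) (∏Terms J l) x y)) (∣m⇒∣m*n _ d)
  ... | no i≢    = subst (p ∣_) (sym (⟦⊛⟧ (J (suc l)) (∏Terms J l) x y)) (∣n⇒∣m*n (⟦ J (suc l) ⟧ x y) (p∣∏ J l 1≤ (≤-pred (≤∧≢⇒< i≤ i≢)) d))

  cancel-≈ : ∀ {a b g} → ¬ p ∣ g → a < p → b < p → a * g ≈ b * g → a ≡ b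
  cancel-≈ {a} {b} {g} p∤g a<p b<p eq = ≤-antisym (half a<p eq) (half b<p (sym eq))
    where
    half : ∀ {a b} → a < p → a * g ≈ b * g → a ≤ b
    half {a} {b} a<p eq with euclidsLemma (a ∸ b) g pr (subst (p ∣_) (sym (*-distribʳ-∸ g a b)) (%-≡⇒∣∸ (a * g) (b * g) p eq))
    ... | inj₂ d = contradiction d p∤g
    ... | inj₁ d with a ∸ b in eq′
    ...   | zero  = m∸n≡0⇒m≤n eq′
    ...   | suc s = contradiction (≤-trans a<p (≤-trans (∣⇒≤ d) (≤-trans (≤-reflexive (sym eq′)) (m∸n≤m a b)))) (<-irrefl refl)

  -- If the matrix is diagonal modulo p with invertible diagonal, then the coefficient vectors in (ℤ/p)^M
  -- embed into (ℤ/p)^D, where D is the number of rank-one terms.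
  diagonal⇒≤ : ∀ {X : Set} (J : Terms X) (cs : List X) →
    (∀ {i j} → i ≢ j → p ∣ ⟦ J ⟧ (List.lookup cs i) (List.lookup cs j)) →
    (∀ i → ¬ p ∣ ⟦ J ⟧ (List.lookup cs i) (List.lookup cs i)) → length cs ≤ length J
  diagonal⇒≤ J cs off diag = ≮⇒≥ λ D<M → <-irrefl refl
    (≤-trans (^-monoʳ-< p (nonTrivial⇒n>1 p {{prime⇒nonTrivial pr}}) D<M) (injective⇒≤ {f = Φ} Φ-injective))
    where
    M = length cs
    D = length J
    c : Fin (p ^ M) → Fin M → Fin p
    c = finToFun
    -- The coefficient vector coded by `a` is applied to the left vectors of the `D` terms. `Φ`
    -- keeps these values modulo `p`; its injectivity would fail by counting if `D < M`.
    image : Fin (p ^ M) → Fin D → ℕ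
    image a d = ∑ (allFin M) (λ i → toℕ (c a i) * proj₁ (List.lookup J d) (List.lookup cs i))
    Φ : Fin (p ^ M) → Fin (p ^ D)
    Φ a = funToFin (λ d → image a d mod p)
    ∑-lookup : ∀ {A : Set} (as : List A) (f : A → ℕ) → ∑ (allFin (length as)) (λ d → f (List.lookup as d)) ≡ ∑ as f
    ∑-lookup []       f = refl
    ∑-lookup (a ∷ as) f = trans (∑-allFin {length as} (λ d → f (List.lookup (a ∷ as) d))) (cong (f a +_) (∑-lookup as f))
    -- Pairing the image with the right vectors at member `j` gives the combination of column `j` of
    -- the matrix. Only its diagonal entry survives modulo `p`, so the image determines the
    -- coefficient `c a j`.
    pairing : ∀ a j → ∑ (allFin D) (λ d → image a d * proj₂ (List.lookup J d) (List.lookup cs j)) ≈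
                      toℕ (c a j) * ⟦ J ⟧ (List.lookup cs j) (List.lookup cs j)
    pairing a j = begin
      ∑ (allFin D) (λ d → image a d * v d) % p
        ≡⟨ cong (_% p) (∑-cong (allFin D) (λ d → sym (∑-*ʳ (allFin M) (v d) _))) ⟩
      ∑ (allFin D) (λ d → ∑ (allFin M) (λ i → toℕ (c a i) * u d i * v d)) % p
        ≡⟨ cong (_% p) (∑-swap (allFin D) (allFin M) _) ⟩
      ∑ (allFin M) (λ i → ∑ (allFin D) (λ d → toℕ (c a i) * u d i * v d)) % p
        ≡⟨ cong (_% p) (∑-cong (allFin M) (λ i → trans (∑-cong (allFin D) (λ d → *-assoc (toℕ (c a i)) (u d i) (v d)))
             (trans (∑-*ˡ (allFin D) (toℕ (c a i)) _) (cong (toℕ (c a i) *_) (∑-lookup J (λ (u , v) → u (x i) * v (x j))))))) ⟩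
      ∑ (allFin M) (λ i → toℕ (c a i) * ⟦ J ⟧ (x i) (x j)) % p
        ≡⟨ ∑-cong-≈ (allFin M) (λ {i} _ → collapse i (i Fin.≟ j)) ⟩
      ∑ (allFin M) (λ i → 𝟙 (j Fin.≟ i) * (toℕ (c a j) * ⟦ J ⟧ (x j) (x j))) % p
        ≡⟨ cong (_% p) (trans (∑-*ʳ (allFin M) _ _) (trans (cong (_* (toℕ (c a j) * ⟦ J ⟧ (x j) (x j))) (∑-𝟙-≟ j)) (*-identityˡ _))) ⟩
      toℕ (c a j) * ⟦ J ⟧ (x j) (x j) % p
        ∎
      where
      open ≡-Reasoning
      x = List.lookup cs
      u : Fin D → Fin M → ℕ
      u d i = proj₁ (List.lookup J d) (x i)
      v : Fin D → ℕ
      v d = proj₂ (List.lookup J d) (x j)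
      collapse : ∀ i → Dec (i ≡ j) → toℕ (c a i) * ⟦ J ⟧ (x i) (x j) ≈ 𝟙 (j Fin.≟ i) * (toℕ (c a j) * ⟦ J ⟧ (x j) (x j))
      collapse i (yes refl) = cong (_% p) (sym (trans (cong (_* (toℕ (c a j) * ⟦ J ⟧ (x j) (x j))) (𝟙-yes (j Fin.≟ j) refl)) (*-identityˡ _)))
      collapse i (no i≢j)   = trans (∣⇒≈0 (∣n⇒∣m*n (toℕ (c a i)) (off i≢j)))
        (cong (_% p) (sym (cong (_* (toℕ (c a j) * ⟦ J ⟧ (x j) (x j))) (𝟙-no (j Fin.≟ i) (i≢j ∘ sym)))))
    image-≈ : ∀ {a b} → Φ a ≡ Φ b → ∀ d → image a d ≈ image b d
    image-≈ {a} {b} eq d = begin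
      image a d % p                        ≡⟨ sym (toℕ-fromℕ< _) ⟩
      toℕ (image a d mod p)                ≡⟨ cong toℕ (sym (finToFun-funToFin (λ d → image a d mod p) d)) ⟩
      toℕ (finToFun {p} {D} (Φ a) d)       ≡⟨ cong (λ t → toℕ (finToFun {p} {D} t d)) eq ⟩
      toℕ (finToFun {p} {D} (Φ b) d)       ≡⟨ cong toℕ (finToFun-funToFin (λ d → image b d mod p) d) ⟩
      toℕ (image b d mod p)                ≡⟨ toℕ-fromℕ< _ ⟩
      image b d % p                        ∎
      where open ≡-Reasoning
    Φ-injective : ∀ {a b} → Φ a ≡ Φ b → a ≡ b
    Φ-injective {a} {b} eq = trans (sym (funToFin-finToFin {M} {p} a)) (trans (funToFin-cong M same) (funToFin-finToFin {M} {p} b))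
      where
      same : ∀ j → c a j ≡ c b j
      same j = toℕ-injective (cancel-≈ (diag j) (toℕ<n (c a j)) (toℕ<n (c b j)) (trans (sym (pairing a j))
        (trans (∑-cong-≈ (allFin D) (λ {d} _ → *-cong-≈ {image a d} (image-≈ {a} {b} eq d) refl)) (pairing b j))))

-- The family of all words

allPairs-∈ : ∀ {X : Set} {R : X → X → Set} → (∀ {x} → R x x) → (∀ {x y} → R x y → R y x) →
  ∀ {xs} → AllPairs R xs → ∀ {x y} → x ∈ xs → y ∈ xs → R x y
allPairs-∈ r s (ps ∷ pss) (here refl) (here refl) = r
allPairs-∈ r s (ps ∷ pss) (here refl) (there y∈)  = All.lookup ps y∈
allPairs-∈ r s (ps ∷ pss) (there x∈)  (here refl) = s (All.lookup ps x∈)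
allPairs-∈ r s (ps ∷ pss) (there x∈)  (there y∈)  = allPairs-∈ r s pss x∈ y∈

allPairs-lookup : ∀ {X : Set} {R : X → X → Set} → (∀ {x y} → R x y → R y x) → ∀ {xs} → AllPairs R xs →
  ∀ {i j} → i ≢ j → R (List.lookup xs i) (List.lookup xs j)
allPairs-lookup s (ps ∷ pss) {zero}  {zero}  i≢j = contradiction refl i≢j
allPairs-lookup s (ps ∷ pss) {zero}  {suc j} i≢j = All.lookup ps (∈-lookup j)
allPairs-lookup s (ps ∷ pss) {suc i} {zero}  i≢j = s (All.lookup ps (∈-lookup i))
allPairs-lookup s (ps ∷ pss) {suc i} {suc j} i≢j = allPairs-lookup s pss (i≢j ∘ cong suc)

⊆-map⁻¹ : ∀ {A B : Set} (f : A → B) {xs ys} → ys ⊆ List.map f xs → ∃[ zs ] zs ⊆ xs × ys ≡ List.map f zs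
⊆-map⁻¹ f {[]}     []           = [] , [] , refl
⊆-map⁻¹ f {x ∷ xs} (_ ∷ʳ s)     = let zs , zs⊆ , eq = ⊆-map⁻¹ f s in zs , x ∷ʳ zs⊆ , eq
⊆-map⁻¹ f {x ∷ xs} (refl ∷ s)   = let zs , zs⊆ , eq = ⊆-map⁻¹ f s in x ∷ zs , refl ∷ zs⊆ , cong (f x ∷_) eq

unique-⊆ : ∀ {X : Set} {xs ys : List X} → xs ⊆ ys → Unique ys → Unique xs
unique-⊆ []          []       = []
unique-⊆ (_ ∷ʳ s)    (_ ∷ u)  = unique-⊆ s u
unique-⊆ (refl ∷ s)  (p ∷ u)  = All-resp-⊆ s p ∷ unique-⊆ s u

∣⁅x⁆∩⁅y⁆∣ : ∀ {n} (x y : Fin n) → ∣ ⁅ x ⁆ ∩ ⁅ y ⁆ ∣ ≡ 𝟙 (x Fin.≟ y)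
∣⁅x⁆∩⁅y⁆∣ x y with x Fin.≟ y
... | yes refl = trans (∣S∩S∣≡∣S∣ ⁅ x ⁆) (∣⁅x⁆∣≡1 x)
... | no x≢y   = n≤0⇒n≡0 (≤-pred (≤-trans (∣F∩G∣<∣F∣ (trans (∣⁅x⁆∣≡1 x) (sym (∣⁅x⁆∣≡1 y))) (x≢y ∘ ⁅⁆-inj)) (≤-reflexive (∣⁅x⁆∣≡1 x))))
  where
  ⁅⁆-inj : ⁅ x ⁆ ≡ ⁅ y ⁆ → x ≡ y
  ⁅⁆-inj eq = x∈⁅y⁆⇒x≡y y (subst (x ∈ˢ_) eq (x∈⁅x⁆ x))

module _ {n : ℕ} where
  open Agreement {Fin n} Fin._≟_

  graph : ∀ {K} → (Fin K → Fin n) → Subset (K * n)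
  graph {zero}  f = []
  graph {suc K} f = ⁅ f zero ⁆ Vec.++ graph (λ i → f (suc i))

  ∣graph∩graph∣ : ∀ {K} (f g : Fin K → Fin n) → ∣ graph f ∩ graph g ∣ ≡ ∣ agree f g ∣
  ∣graph∩graph∣ {zero}  f g = refl
  ∣graph∩graph∣ {suc K} f g = begin
    ∣ (⁅ f zero ⁆ Vec.++ graph f′) ∩ (⁅ g zero ⁆ Vec.++ graph g′) ∣   ≡⟨ cong ∣_∣ (++-∩ ⁅ f zero ⁆ ⁅ g zero ⁆ (graph f′) (graph g′)) ⟩
    ∣ (⁅ f zero ⁆ ∩ ⁅ g zero ⁆) Vec.++ (graph f′ ∩ graph g′) ∣        ≡⟨ ∣++∣ (⁅ f zero ⁆ ∩ ⁅ g zero ⁆) (graph f′ ∩ graph g′) ⟩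
    ∣ ⁅ f zero ⁆ ∩ ⁅ g zero ⁆ ∣ + ∣ graph f′ ∩ graph g′ ∣             ≡⟨ cong₂ _+_ (∣⁅x⁆∩⁅y⁆∣ (f zero) (g zero)) (∣graph∩graph∣ f′ g′) ⟩
    𝟙 (f zero Fin.≟ g zero) + ∣ agree f′ g′ ∣                         ≡⟨ sym (∣does∷∣ (f zero Fin.≟ g zero) (agree f′ g′)) ⟩
    ∣ agree f g ∣                                                     ∎
    where
    open ≡-Reasoning
    f′ = λ i → f (suc i)
    g′ = λ i → g (suc i)

  agree-sym : ∀ {K} (f g : Fin K → Fin n) → agree f g ≡ agree g f
  agree-sym f g = ⊆ˢ-antisym (λ l∈ → ∈-agree⁺ g f (sym (∈-agree⁻ f g l∈))) (λ l∈ → ∈-agree⁺ f g (sym (∈-agree⁻ g f l∈)))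

  ∣agree-refl∣ : ∀ {K} (f : Fin K → Fin n) → ∣ agree f f ∣ ≡ K
  ∣agree-refl∣ {K} f = trans (cong ∣_∣ {y = ⊤} (⊆ˢ-antisym (λ _ → ∈⊤) (λ _ → ∈-agree⁺ f f refl))) (∣⊤∣≡n K)

  ∣agree∣<K : ∀ {K} (f g : Fin K → Fin n) → ¬ (∀ l → f l ≡ g l) → ∣ agree f g ∣ < K
  ∣agree∣<K f g f≢g = ≤∧≢⇒< (∣p∣≤n (agree f g)) (λ eq → f≢g (λ l → ∈-agree⁻ f g (subst (l ∈ˢ_) (sym (∣p∣≡n⇒p≡⊤ eq)) ∈⊤)))

  -- Presents equality of two letters as a sum of `n` rank-one terms, which is what `factor` is made
  -- of.
  ∑-𝟙*𝟙 : ∀ (x y : Fin n) → ∑ (allFin n) (λ a → 𝟙 (x Fin.≟ a) * 𝟙 (y Fin.≟ a)) ≡ 𝟙 (x Fin.≟ y)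
  ∑-𝟙*𝟙 x y with x Fin.≟ y
  ... | yes refl = trans (∑-cong (allFin n) (λ a → idem (x Fin.≟ a))) (∑-𝟙-≟ x)
    where
    idem : ∀ {P : Set} (P? : Dec P) → 𝟙 P? * 𝟙 P? ≡ 𝟙 P?
    idem (yes _) = refl
    idem (no _)  = refl
  ... | no x≢y = trans (∑-cong (allFin n) (λ a → both (x Fin.≟ a) (y Fin.≟ a) (λ { refl → λ y≡a → x≢y (sym y≡a) }))) (∑-0 (allFin n))
    where
    both : ∀ {P Q : Set} (P? : Dec P) (Q? : Dec Q) → (P → ¬ Q) → 𝟙 P? * 𝟙 Q? ≡ 0
    both (yes p) (yes q) f = contradiction q (f p)
    both (yes _) (no _)  f = refl
    both (no _)  Q?      f = refl

module Words {p : ℕ} (pr : Prime p) {k′ n : ℕ} .{{_ : NonZero n}} (0<k′ : 0 < k′) where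
  open Agreement {Fin n} Fin._≟_
  private instance
    _ = prime⇒nonZero pr

  N : ℕ
  N = n ^ k′

  word : Fin N → Fin k′ → Fin n
  word = finToFun

  agreement : Fin N → Fin N → ℕ
  agreement a b = ∣ agree (word a) (word b) ∣

  word-injective : ∀ {a b} → (∀ l → word a l ≡ word b l) → a ≡ b
  word-injective {a} {b} eq = trans (sym (funToFin-finToFin {k′} {n} a)) (trans (funToFin-cong k′ eq) (funToFin-finToFin {k′} {n} b))

  agreement< : ∀ {a b} → a ≢ b → agreement a b < k′
  agreement< {a} {b} a≢b = ∣agree∣<K (word a) (word b) (λ eq → a≢b (word-injective eq))

  Congruent : Fin N → Fin N → Set
  Congruent a b = agreement a b % p ≡ k′ % p

  congruent-sym : ∀ {a b} → Congruent a b → Congruent b a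
  congruent-sym {a} {b} = trans (cong (λ S → ∣ S ∣ % p) (agree-sym (word b) (word a)))

  congruent-refl : ∀ {a} → Congruent a a
  congruent-refl {a} = cong (_% p) (∣agree-refl∣ (word a))

  -- Represents `- k′` modulo `p` without subtraction.
  shift : ℕ
  shift = k′ * (p ∸ 1)

  k′+shift : k′ + shift ≡ k′ * p
  k′+shift = trans (sym (*-suc k′ (p ∸ 1))) (cong (k′ *_) (suc-pred p))

  factor : ℕ → Terms (Fin N)
  factor l = ((λ _ → 1) , (λ _ → shift + l)) ∷
    cartesianProductWith (λ i c → (λ a → 𝟙 (word a i Fin.≟ c)) , (λ b → 𝟙 (word b i Fin.≟ c))) (allFin k′) (allFin n)

  length-factor : ∀ l → length (factor l) ≡ suc (k′ * n)
  length-factor l = cong suc (trans (length-cartesianProductWith _ (allFin k′) (allFin n))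
    (cong₂ _*_ (length-tabulate {n = k′} id) (length-tabulate {n = n} id)))

  ⟦factor⟧ : ∀ l a b → ⟦ factor l ⟧ a b ≡ agreement a b + shift + l
  ⟦factor⟧ l a b = begin
    1 * (shift + l) + _                   ≡⟨ cong₂ _+_ (*-identityˡ (shift + l)) (∑-cartesianProductWith _ (allFin k′) (allFin n) _) ⟩
    shift + l + ∑ (allFin k′) (λ i → ∑ (allFin n) (λ c → 𝟙 (word a i Fin.≟ c) * 𝟙 (word b i Fin.≟ c)))
                                          ≡⟨ cong (shift + l +_) (∑-cong (allFin k′) (λ i → ∑-𝟙*𝟙 (word a i) (word b i))) ⟩
    shift + l + ∑ (allFin k′) (λ i → 𝟙 (word a i Fin.≟ word b i))
                                          ≡⟨ cong (shift + l +_) (sym (∣tabulate∣≡∑ (λ i → word a i Fin.≟ word b i))) ⟩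
    shift + l + agreement a b             ≡⟨ +-comm (shift + l) _ ⟩
    agreement a b + (shift + l)           ≡⟨ sym (+-assoc (agreement a b) shift l) ⟩
    agreement a b + shift + l             ∎
    where open ≡-Reasoning

  -- Modulo p this is the product of e − k′ + l over 1 ≤ l < p, where e is the agreement:
  -- it is nonzero exactly when e ≡ k′.
  terms : Terms (Fin N)
  terms = ∏Terms factor (p ∸ 1)

  -- On the diagonal the factors are `k′ * p + l` with `1 ≤ l < p`.
  p∤diagonal : ∀ a → ¬ p ∣ ⟦ terms ⟧ a a
  p∤diagonal a = p∤∏ pr factor (p ∸ 1) λ l 1≤l l≤ d → <-irrefl refl (≤-trans (s≤s l≤) (≤-trans (≤-reflexive (suc-pred p))
    (∣⇒≤ {{>-nonZero 1≤l}} (∣m+n∣m⇒∣n (subst (p ∣_) (trans (⟦factor⟧ l a a)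
      (cong (_+ l) (trans (cong (_+ shift) (∣agree-refl∣ (word a))) k′+shift))) d) (divides k′ refl)))))

  -- If `agreement a b + shift` has residue `r`, the factor with `l = p ∸ r` vanishes modulo `p`.
  -- Incongruence means `r ≢ 0`, so this `l` is among the factors.
  p∣offDiagonal : ∀ {a b} → ¬ Congruent a b → p ∣ ⟦ terms ⟧ a b
  p∣offDiagonal {a} {b} incongruent = p∣∏ pr factor (p ∸ 1) {a} {b} {l} (m<n⇒0<n∸m (m%n<n t p)) l≤ (subst (p ∣_) (sym (⟦factor⟧ l a b))
    (divides (suc (t / p)) (begin
      t + l                      ≡⟨ cong (_+ l) (m≡m%n+[m/n]*n t p) ⟩
      r + t / p * p + l          ≡⟨ cong (_+ l) (+-comm r _) ⟩
      t / p * p + r + l          ≡⟨ +-assoc (t / p * p) r l ⟩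
      t / p * p + (r + l)        ≡⟨ cong (t / p * p +_) (m+[n∸m]≡n (<⇒≤ (m%n<n t p))) ⟩
      t / p * p + p              ≡⟨ +-comm (t / p * p) p ⟩
      suc (t / p) * p            ∎)))
    where
    open ≡-Reasoning
    e = agreement a b
    t = e + shift
    r = t % p
    l = p ∸ r
    r≢0 : r ≢ 0
    r≢0 r≡0 = incongruent (begin
      e % p                      ≡⟨ sym (%-remove-+ʳ e {d = p} (divides k′ refl)) ⟩
      (e + k′ * p) % p           ≡⟨ cong (λ s → (e + s) % p) (trans (sym k′+shift) (+-comm k′ shift)) ⟩
      (e + (shift + k′)) % p     ≡⟨ cong (_% p) (sym (+-assoc e shift k′)) ⟩
      (t + k′) % p               ≡⟨ %-remove-+ˡ k′ (m%n≡0⇒n∣m t p r≡0) ⟩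
      k′ % p                     ∎)
    l≤ : l ≤ p ∸ 1
    l≤ = ∸-monoʳ-≤ p (n≢0⇒n>0 r≢0)

  clique≤ : ∀ {cs} → AllPairs (λ a b → ¬ Congruent a b) cs → length cs ≤ suc (k′ * n) ^ (p ∸ 1)
  clique≤ {cs} incongruent = ≤-trans
    (diagonal⇒≤ pr terms cs (λ i≢j → p∣offDiagonal (allPairs-lookup (λ {a} {b} h → h ∘ congruent-sym {b} {a}) incongruent i≢j)) (λ i → p∤diagonal _))
    (≤-reflexive (length-∏Terms factor length-factor (p ∸ 1)))

  independent : ∀ {cs} → Unique cs → AllPairs Congruent cs → length cs ≤ 2 ^ k′ * (n * 2 ^ k′) ^ (k′ / p)
  independent u cong′ = IndependentSets.independentSet≤ {p = p} word word-injective u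
    (allPairs-∈ (λ {a} → congruent-refl {a}) (λ {a} {b} → congruent-sym {a} {b}) cong′)

module Family {p : ℕ} (pr : Prime p) {k k′ n : ℕ} .{{_ : NonZero n}} (0<k′ : 0 < k′) (k′≤k : k′ ≤ k) where
  open Words pr {k′} {n} 0<k′
  private instance
    _ = prime⇒nonZero pr

  -- The last k − k′ coordinates hold the word itself, so they separate all members of the family.
  label : Fin N → Fin (k ∸ k′) → Fin N
  label a _ = a

  tag : Fin N → Subset ((k ∸ k′) * N)
  tag a = graph (label a)

  set : Fin N → Subset (k′ * n + (k ∸ k′) * N)
  set a = graph (word a) Vec.++ tag a

  ∣set∩set∣ : ∀ a b → ∣ set a ∩ set b ∣ ≡ agreement a b + ∣ tag a ∩ tag b ∣
  ∣set∩set∣ a b = trans (cong ∣_∣ (++-∩ (graph (word a)) (graph (word b)) (tag a) (tag b)))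
    (trans (∣++∣ (graph (word a) ∩ graph (word b)) (tag a ∩ tag b)) (cong (_+ ∣ tag a ∩ tag b ∣) (∣graph∩graph∣ (word a) (word b))))

  ∣set∣ : ∀ a → ∣ set a ∣ ≡ k
  ∣set∣ a = begin
    ∣ set a ∣                             ≡⟨ sym (∣S∩S∣≡∣S∣ (set a)) ⟩
    ∣ set a ∩ set a ∣                     ≡⟨ ∣set∩set∣ a a ⟩
    agreement a a + ∣ tag a ∩ tag a ∣     ≡⟨ cong₂ _+_ (∣agree-refl∣ (word a)) (trans (∣graph∩graph∣ (label a) (label a)) (∣agree-refl∣ (label a))) ⟩
    k′ + (k ∸ k′)                         ≡⟨ m+[n∸m]≡n k′≤k ⟩
    k                                     ∎
    where open ≡-Reasoning

  ∣set∩set∣-≢ : ∀ {a b} → a ≢ b → ∣ set a ∩ set b ∣ ≡ agreement a b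
  ∣set∩set∣-≢ {a} {b} a≢b = trans (∣set∩set∣ a b) (trans (cong (agreement a b +_)
      (trans (∣graph∩graph∣ (label a) (label b)) (none (k ∸ k′)))) (+-identityʳ _))
    where
    open Agreement {Fin N} Fin._≟_ using (agree)
    none : ∀ K → ∣ agree {K} (λ _ → a) (λ _ → b) ∣ ≡ 0
    none zero    = refl
    none (suc K) = trans (∣does∷∣ (a Fin.≟ b) (agree {K} (λ _ → a) (λ _ → b))) (cong₂ _+_ (𝟙-no (a Fin.≟ b) a≢b) (none K))

  set-injective : ∀ {a b} → set a ≡ set b → a ≡ b
  set-injective {a} {b} eq with a Fin.≟ b
  ... | yes a≡b = a≡b
  ... | no a≢b  = contradiction (≤-trans (agreement< a≢b) k′≤k) (<-irrefl (sym (begin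
    k                  ≡⟨ sym (∣set∣ a) ⟩
    ∣ set a ∣          ≡⟨ sym (∣S∩S∣≡∣S∣ (set a)) ⟩
    ∣ set a ∩ set a ∣  ≡⟨ cong (λ S → ∣ set a ∩ S ∣) eq ⟩
    ∣ set a ∩ set b ∣  ≡⟨ ∣set∩set∣-≢ a≢b ⟩
    agreement a b      ∎)))
    where open ≡-Reasoning

  family : List (Subset (k′ * n + (k ∸ k′) * N))
  family = List.map set (allFin N)

  length-family : length family ≡ N
  length-family = trans (length-map set (allFin N)) (length-tabulate {n = N} id)

  system : IsKSystem k _ family
  system = Unique.map⁺ set-injective (Unique.allFin⁺ N) , All.map⁺ (All.universal ∣set∣ (allFin N))

  unlabel : ∀ {𝓖} → 𝓖 ⊆ family → ∃[ cs ] Unique cs × 𝓖 ≡ List.map set cs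
  unlabel 𝓖⊆ = let cs , cs⊆ , eq = ⊆-map⁻¹ set 𝓖⊆ in cs , unique-⊆ cs⊆ (Unique.allFin⁺ N) , eq

  module _ {InL : ℕ → Set} (inL : ∀ {ℓ} → ℓ < k → ℓ % p ≢ k′ % p → InL ℓ) (notInL : ∀ {ℓ} → InL ℓ → ℓ % p ≢ k′ % p) where

    -- The trivial bound by `N` serves the alphabet of size 1, where the family has a single member
    -- and so no clique of size at least 2.
    clique-bound : ∀ {m} → HasClique InL m family → m ≤ suc (k′ * n) ^ (p ∸ 1) × m ≤ N
    clique-bound (𝓒 , 𝓒⊆ , refl , clique) with unlabel 𝓒⊆
    ... | cs , u , refl = ≤-trans (≤-reflexive (length-map set cs)) (clique≤ {cs} (AllPairs.zipWith
        (λ { {a} {b} (a≢b , il) → subst (λ e → e % p ≢ k′ % p) (∣set∩set∣-≢ a≢b) (notInL il) }) (u , AllPairs.map⁻ clique))) ,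
      ≤-trans (length-mono-≤ 𝓒⊆) (≤-reflexive length-family)

    avoiding-bound : ∀ {𝓖} → 𝓖 ⊆ family → Avoids InL 𝓖 → length 𝓖 ≤ 2 ^ k′ * (n * 2 ^ k′) ^ (k′ / p)
    avoiding-bound 𝓖⊆ avoids with unlabel 𝓖⊆
    ... | cs , u , refl = ≤-trans (≤-reflexive (length-map set cs)) (independent u (AllPairs.zipWith
      (λ { {a} {b} (a≢b , ¬il) → decidable-stable (agreement a b % p ≟ k′ % p) (λ incongruent → ¬il (inL
        (≤-trans (s≤s (≤-reflexive (∣set∩set∣-≢ a≢b))) (≤-trans (agreement< a≢b) k′≤k))
        (subst (λ e → e % p ≢ k′ % p) (sym (∣set∩set∣-≢ a≢b)) incongruent))) }) (u , AllPairs.map⁻ avoids)))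

-- suc (k′ * n) ^ d bounds the cliques over an alphabet of size n.
chooseAlphabet : ∀ k′ d → 0 < k′ → 0 < d → ∀ m → ∃[ n ] 0 < n × (n ≡ 1 ⊎ suc (k′ * n) ^ d < m) × m ≤ suc (k′ * suc n) ^ d
chooseAlphabet k′ d 0<k′ 0<d zero    = 1 , s≤s z≤n , inj₁ refl , z≤n
chooseAlphabet k′ d 0<k′ 0<d (suc m) with chooseAlphabet k′ d 0<k′ 0<d m
... | n , 0<n , small , m≤ with suc m ≤? suc (k′ * suc n) ^ d
...   | yes sm≤ = n , 0<n , [ inj₁ , inj₂ ∘ m<n⇒m<1+n ]′ small , sm≤
-- The failed comparison is exactly the smallness required of `suc n`. The other bound holds because
-- enlarging the alphabet raises the power by at least 1.
...   | no sm≰  = suc n , s≤s z≤n , inj₂ (≰⇒> sm≰) ,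
  ≤-trans (s≤s m≤) (^-monoˡ-< d {{>-nonZero 0<d}} (s≤s (*-monoʳ-< k′ {{>-nonZero 0<k′}} (n<1+n (suc n)))))

-- The powers of 2 come from the bound on independent sets, the last factor from
-- `m ≤ (3 * k * n) ^ (p ∸ 1)`.
upperConstant : ℕ → ℕ
upperConstant k = 2 ^ k * (2 ^ k) ^ k * (3 * k) ^ k

-- Up to constants, `m ^ a` is at most `n ^ ((p ∸ 1) * j)` with `j = k′ / p`, and an independent set
-- has at most `n ^ j` members. The exponents add up to `p * j ≤ k′`.
alphabet-arithmetic : ∀ {p k k′ n m a} .{{_ : NonZero p}} → 0 < n → 0 < k′ → k′ ≤ k → a ≤ k′ / p → 0 < m →
  m ≤ suc (k′ * suc n) ^ (p ∸ 1) → 2 ^ k′ * (n * 2 ^ k′) ^ (k′ / p) * m ^ a ≤ upperConstant k * n ^ k′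
alphabet-arithmetic {p} {k} {k′} {n} {m} {a} 0<n 0<k′ k′≤k a≤j 0<m m≤ = begin
  2 ^ k′ * (n * 2 ^ k′) ^ j * m ^ a
    ≤⟨ *-mono-≤ (*-mono-≤ (^-monoʳ-≤ 2 k′≤k) (≤-reflexive (^-distribʳ-* n (2 ^ k′) j)))
                (≤-trans (^-monoʳ-≤ m {{>-nonZero 0<m}} a≤j) (^-monoˡ-≤ j (≤-trans m≤ (^-monoˡ-≤ (p ∸ 1) linear)))) ⟩
  2 ^ k * (n ^ j * (2 ^ k′) ^ j) * ((3 * k * n) ^ (p ∸ 1)) ^ j
    ≤⟨ *-mono-≤ (*-monoʳ-≤ (2 ^ k) (*-monoʳ-≤ (n ^ j) (≤-trans (^-monoˡ-≤ j (^-monoʳ-≤ 2 k′≤k))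
                  (^-monoʳ-≤ (2 ^ k) {{m^n≢0 2 k}} (≤-trans (m/n≤m k′ p) k′≤k)))))
                (≤-reflexive (trans (^-*-assoc (3 * k * n) (p ∸ 1) j) (^-distribʳ-* (3 * k) n q))) ⟩
  2 ^ k * (n ^ j * (2 ^ k) ^ k) * ((3 * k) ^ q * n ^ q)
    ≤⟨ *-monoʳ-≤ (2 ^ k * (n ^ j * (2 ^ k) ^ k)) (*-monoˡ-≤ (n ^ q) (^-monoʳ-≤ (3 * k) {{3k≢0}} q≤k)) ⟩
  2 ^ k * (n ^ j * (2 ^ k) ^ k) * ((3 * k) ^ k * n ^ q)
    ≡⟨ rearrange (2 ^ k) (n ^ j) ((2 ^ k) ^ k) ((3 * k) ^ k) (n ^ q) ⟩
  upperConstant k * (n ^ j * n ^ q)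
    ≡⟨ cong (upperConstant k *_) (sym (^-distribˡ-+-* n j q)) ⟩
  upperConstant k * n ^ (j + q)
    ≤⟨ *-monoʳ-≤ (upperConstant k) (^-monoʳ-≤ n {{>-nonZero 0<n}} j+q≤) ⟩
  upperConstant k * n ^ k′
    ∎
  where
  open ≤-Reasoning
  j = k′ / p
  q = (p ∸ 1) * j
  0<k : 0 < k
  0<k = ≤-trans 0<k′ k′≤k
  3k≢0 : NonZero (3 * k)
  3k≢0 = m*n≢0 3 k {{_}} {{>-nonZero 0<k}}
  j+q≤ : j + q ≤ k′
  j+q≤ = ≤-trans (≤-reflexive (trans (cong (_* j) (suc-pred p)) (*-comm p j))) (m/n*n≤m k′ p)
  q≤k : q ≤ k
  q≤k = ≤-trans (m≤n+m q j) (≤-trans j+q≤ k′≤k)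
  rearrange : ∀ a b c d e → a * (b * c) * (d * e) ≡ a * c * d * (b * e)
  rearrange = solve-∀
  linear : suc (k′ * suc n) ≤ 3 * k * n
  linear = begin
    suc (k′ * suc n)              ≤⟨ s≤s (*-monoˡ-≤ (suc n) k′≤k) ⟩
    1 + k * suc n                 ≡⟨ cong suc (*-suc k n) ⟩
    1 + (k + k * n)               ≤⟨ +-mono-≤ (*-mono-≤ 0<k 0<n) (+-monoˡ-≤ (k * n) (m≤m*n k n {{>-nonZero 0<n}})) ⟩
    k * n + (k * n + k * n)       ≡⟨ triple k n ⟩
    3 * k * n                     ∎
    where
    triple : ∀ a b → a * b + (a * b + a * b) ≡ 3 * a * b
    triple = solve-∀

-- Rational estimates

ratio : ∀ a d → toℚᵘ ((ℤ.+ a) ℚ./ suc d) ≃ mkℚᵘ (ℤ.+ a) d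
ratio a d = toℚᵘ-fromℚᵘ (mkℚᵘ (ℤ.+ a) d)

ℕ→ℚ-* : ∀ a b → ℕ→ℚ (a * b) ≡ ℕ→ℚ a ℚ.* ℕ→ℚ b
ℕ→ℚ-* a b = toℚᵘ-injective (begin
  toℚᵘ (ℕ→ℚ (a * b))                 ≈⟨ ratio (a * b) 0 ⟩
  mkℚᵘ (ℤ.+ (a * b)) 0               ≈⟨ *≡* (cong (ℤ._* ℤ.+ 1) (ℤ.pos-* a b)) ⟩
  mkℚᵘ (ℤ.+ a) 0 ℚᵘ.* mkℚᵘ (ℤ.+ b) 0   ≈⟨ ℚᵘ.*-cong (ratio a 0) (ratio b 0) ⟨
  toℚᵘ (ℕ→ℚ a) ℚᵘ.* toℚᵘ (ℕ→ℚ b)       ≈⟨ toℚᵘ-homo-* (ℕ→ℚ a) (ℕ→ℚ b) ⟨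
  toℚᵘ (ℕ→ℚ a ℚ.* ℕ→ℚ b)               ∎)
  where open ℚᵘ.≃-Reasoning

ℕ→ℚ-mono-≤ : ∀ {a b} → a ≤ b → ℕ→ℚ a ℚ.≤ ℕ→ℚ b
ℕ→ℚ-mono-≤ {a} {b} a≤b = toℚᵘ-cancel-≤ (ℚᵘ.≤-respˡ-≃ (ℚᵘ.≃-sym (ratio a 0)) (ℚᵘ.≤-respʳ-≃ (ℚᵘ.≃-sym (ratio b 0))
  (*≤* (ℤ.*-monoʳ-≤-nonNeg (ℤ.+ 1) (ℤ.+≤+ a≤b)))))

0<ratio : ∀ a d → 0ℚ ℚ.< (ℤ.+ suc a) ℚ./ suc d
0<ratio a d = toℚᵘ-cancel-< (ℚᵘ.<-respʳ-≃ (ℚᵘ.≃-sym (ratio (suc a) d)) (*<* (ℤ.+<+ (s≤s z≤n))))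

inv-* : ∀ d .{{_ : NonZero d}} → inv d ℚ.* ℕ→ℚ d ≡ 1ℚ
inv-* (suc d) = toℚᵘ-injective (begin
  toℚᵘ (inv (suc d) ℚ.* ℕ→ℚ (suc d))               ≈⟨ toℚᵘ-homo-* (inv (suc d)) (ℕ→ℚ (suc d)) ⟩
  toℚᵘ (inv (suc d)) ℚᵘ.* toℚᵘ (ℕ→ℚ (suc d))       ≈⟨ ℚᵘ.*-cong (ratio 1 d) (ratio (suc d) 0) ⟩
  mkℚᵘ (ℤ.+ 1) d ℚᵘ.* mkℚᵘ (ℤ.+ suc d) 0           ≈⟨ *≡* (cong ℤ.+_ (cong suc (trans (*-identityʳ _) (cong (_+ 0) (sym (*-identityʳ d)))))) ⟩
  mkℚᵘ (ℤ.+ 1) 0                                   ≈⟨ ratio 1 0 ⟨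
  toℚᵘ 1ℚ                                          ∎)
  where open ℚᵘ.≃-Reasoning

0≤inv : ∀ d → 0ℚ ℚ.≤ inv d
0≤inv 0       = ℚ.≤-refl
0≤inv (suc d) = ℚ.<⇒≤ (0<ratio 0 d)

0≤ℕ→ℚ : ∀ a → 0ℚ ℚ.≤ ℕ→ℚ a
0≤ℕ→ℚ a = ℕ→ℚ-mono-≤ {0} {a} z≤n

0≤* : ∀ {x y} → 0ℚ ℚ.≤ x → 0ℚ ℚ.≤ y → 0ℚ ℚ.≤ x ℚ.* y
0≤* {x} {y} 0≤x 0≤y = ℚ.nonNegative⁻¹ (x ℚ.* y) {{ℚ.nonNeg*nonNeg⇒nonNeg x {{ℚ.nonNegative 0≤x}} y {{ℚ.nonNegative 0≤y}}}}

scaleʳ : ∀ {x y} c → 0ℚ ℚ.≤ c → x ℚ.≤ y → x ℚ.* c ℚ.≤ y ℚ.* c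
scaleʳ c 0≤c x≤y = ℚ.*-monoʳ-≤-nonNeg c {{ℚ.nonNegative 0≤c}} x≤y

open +-*-Solver using (solve; _:*_; _:=_)

fraction-≤ : ∀ {a b} Z M .{{_ : NonZero Z}} .{{_ : NonZero M}} → a ≤ Z * M * b → inv Z ℚ.* inv M ℚ.* ℕ→ℚ a ℚ.≤ ℕ→ℚ b
fraction-≤ {a} {b} Z M a≤ = begin
  inv Z ℚ.* inv M ℚ.* ℕ→ℚ a                            ≡⟨ ℚ.*-comm (inv Z ℚ.* inv M) (ℕ→ℚ a) ⟩
  ℕ→ℚ a ℚ.* (inv Z ℚ.* inv M)                          ≤⟨ scaleʳ _ (0≤* (0≤inv Z) (0≤inv M)) (ℕ→ℚ-mono-≤ a≤) ⟩
  ℕ→ℚ (Z * M * b) ℚ.* (inv Z ℚ.* inv M)            ≡⟨ cong (ℚ._* (inv Z ℚ.* inv M)) (trans (ℕ→ℚ-* (Z * M) b) (cong (ℚ._* ℕ→ℚ b) (ℕ→ℚ-* Z M))) ⟩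
  ℕ→ℚ Z ℚ.* ℕ→ℚ M ℚ.* ℕ→ℚ b ℚ.* (inv Z ℚ.* inv M)      ≡⟨ rearrange (ℕ→ℚ Z) (ℕ→ℚ M) (ℕ→ℚ b) (inv Z) (inv M) ⟩
  (inv Z ℚ.* ℕ→ℚ Z) ℚ.* (inv M ℚ.* ℕ→ℚ M) ℚ.* ℕ→ℚ b    ≡⟨ cong (ℚ._* ℕ→ℚ b) (cong₂ ℚ._*_ (inv-* Z) (inv-* M)) ⟩
  1ℚ ℚ.* 1ℚ ℚ.* ℕ→ℚ b                                  ≡⟨ ℚ.*-identityˡ (ℕ→ℚ b) ⟩
  ℕ→ℚ b                                                ∎
  where
  open ℚ.≤-Reasoning
  rearrange : ∀ z m b z′ m′ → z ℚ.* m ℚ.* b ℚ.* (z′ ℚ.* m′) ≡ (z′ ℚ.* z) ℚ.* (m′ ℚ.* m) ℚ.* b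
  rearrange = solve 5 (λ z m b z′ m′ → z :* m :* b :* (z′ :* m′) := (z′ :* z) :* (m′ :* m) :* b) refl

≤-fraction : ∀ {α b} N M U .{{_ : NonZero N}} .{{_ : NonZero M}} →
  α ℚ.* ℕ→ℚ N ℚ.≤ ℕ→ℚ b → b * M ≤ U * N → α ℚ.≤ ℕ→ℚ U ℚ.* inv M
≤-fraction {α} {b} N M U αN≤ bM≤ = begin
  α                                                    ≡⟨ sym (trans (cong₂ (λ s t → α ℚ.* s ℚ.* t) (inv-* N) (inv-* M)) (trans (ℚ.*-identityʳ (α ℚ.* 1ℚ)) (ℚ.*-identityʳ α))) ⟩
  α ℚ.* (inv N ℚ.* ℕ→ℚ N) ℚ.* (inv M ℚ.* ℕ→ℚ M)        ≡⟨ rearrange₁ α (inv N) (ℕ→ℚ N) (inv M) (ℕ→ℚ M) ⟩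
  (α ℚ.* ℕ→ℚ N) ℚ.* (ℕ→ℚ M ℚ.* (inv N ℚ.* inv M))      ≤⟨ scaleʳ _ (0≤* (0≤ℕ→ℚ M) 0≤NM) αN≤ ⟩
  ℕ→ℚ b ℚ.* (ℕ→ℚ M ℚ.* (inv N ℚ.* inv M))              ≡⟨ sym (ℚ.*-assoc (ℕ→ℚ b) (ℕ→ℚ M) (inv N ℚ.* inv M)) ⟩
  ℕ→ℚ b ℚ.* ℕ→ℚ M ℚ.* (inv N ℚ.* inv M)                ≡⟨ cong (ℚ._* (inv N ℚ.* inv M)) (sym (ℕ→ℚ-* b M)) ⟩
  ℕ→ℚ (b * M) ℚ.* (inv N ℚ.* inv M)                  ≤⟨ scaleʳ _ 0≤NM (ℕ→ℚ-mono-≤ bM≤) ⟩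
  ℕ→ℚ (U * N) ℚ.* (inv N ℚ.* inv M)                  ≡⟨ cong (ℚ._* (inv N ℚ.* inv M)) (ℕ→ℚ-* U N) ⟩
  ℕ→ℚ U ℚ.* ℕ→ℚ N ℚ.* (inv N ℚ.* inv M)                ≡⟨ rearrange₂ (ℕ→ℚ U) (ℕ→ℚ N) (inv N) (inv M) ⟩
  ℕ→ℚ U ℚ.* inv M ℚ.* (inv N ℚ.* ℕ→ℚ N)                ≡⟨ trans (cong (ℕ→ℚ U ℚ.* inv M ℚ.*_) (inv-* N)) (ℚ.*-identityʳ _) ⟩
  ℕ→ℚ U ℚ.* inv M                                      ∎
  where
  open ℚ.≤-Reasoning
  0≤NM : 0ℚ ℚ.≤ inv N ℚ.* inv M
  0≤NM = 0≤* (0≤inv N) (0≤inv M)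
  rearrange₁ : ∀ a n′ n m′ m → a ℚ.* (n′ ℚ.* n) ℚ.* (m′ ℚ.* m) ≡ (a ℚ.* n) ℚ.* (m ℚ.* (n′ ℚ.* m′))
  rearrange₁ = solve 5 (λ a n′ n m′ m → a :* (n′ :* n) :* (m′ :* m) := (a :* n) :* (m :* (n′ :* m′))) refl
  rearrange₂ : ∀ u n n′ m′ → u ℚ.* n ℚ.* (n′ ℚ.* m′) ≡ u ℚ.* m′ ℚ.* (n′ ℚ.* n)
  rearrange₂ = solve 4 (λ u n n′ m′ → u :* n :* (n′ :* m′) := u :* m′ :* (n′ :* n)) refl

-- The missing residue and the bounds on r(k, L, m)

MissingOnly : ∀ {n} → Subset n → Fin n → Set
MissingOnly L r = r ∉ˢ L × (∀ {x} → x ≢ r → x ∈ˢ L)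

missing : ∀ {n} (L : Subset n) → suc ∣ L ∣ ≡ n → ∃ (MissingOnly L)
missing (outside ∷ L) eq = zero , (λ ()) , λ { {zero} x≢ → contradiction refl x≢
                                             ; {suc x} _ → there (subst (x ∈ˢ_) (sym (∣p∣≡n⇒p≡⊤ (suc-injective eq))) ∈⊤) }
missing (inside ∷ L) eq with missing L (suc-injective eq)
... | r , r∉ , rest = suc r , r∉ ∘ drop-thereˢ , λ { {zero} _ → here ; {suc x} x≢ → there (rest (x≢ ∘ cong suc)) }

-- The bound is itself admissible, hence one witness for every `β` below it.
lowerBd : ∀ {k P m} Z a .{{_ : NonZero m}} .{{_ : NonZero Z}} →
  (∀ {n} {𝓕 : List (Subset n)} → IsKSystem k n 𝓕 → ¬ HasClique P m 𝓕 →
    Σ[ 𝓕′ ∈ List (Subset n) ] 𝓕′ ⊆ 𝓕 × Avoids P 𝓕′ × length 𝓕 ≤ Z * m ^ a * length 𝓕′) →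
  LowerBd k P m (inv Z · m ^- a)
lowerBd {m = m} Z a find β β< = inv Z · m ^- a , 0≤* (0≤inv Z) (0≤inv (m ^ a)) ,
  (λ n 𝓕 system noClique → let 𝓕′ , sub , avoids , large = find system noClique in
    𝓕′ , sub , avoids , fraction-≤ {length 𝓕} {length 𝓕′} Z (m ^ a) {{it}} {{m^n≢0 m a}} large) ,
  ℚ.<⇒≤ β<

module _ {k p m : ℕ} (pr : Prime p) (p≤k : p ≤ k) (2≤m : 2 ≤ m) {L : Subset p} {r : Fin p} (L-misses : MissingOnly L r) where
  private instance
    _ = prime⇒nonZero pr
    _ = >-nonZero (≤-trans (s≤s z≤n) 2≤m)
    _ = >-nonZero (≤-trans (>-nonZero⁻¹ p) p≤k)

  Forbidden : ℕ → Set
  Forbidden = InL' k p pr L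

  inL : ∀ ℓ → ℓ < k → ℓ % p ≢ toℕ r → Forbidden ℓ
  inL ℓ ℓ<k ≢r = ℓ<k , proj₂ L-misses (λ eq → ≢r (trans (sym (toℕ-fromℕ< (m%n<n ℓ p))) (cong toℕ eq)))

  notInL : ∀ ℓ → ℓ % p ≡ toℕ r → ¬ Forbidden ℓ
  notInL ℓ ≡r (_ , ∈L) = proj₁ L-misses (subst (_∈ˢ L) (toℕ-injective (trans (toℕ-fromℕ< (m%n<n ℓ p)) ≡r)) ∈L)

  module Lower {n} {𝓕 : List (Subset n)} (system : IsKSystem k n 𝓕) (noClique : ¬ HasClique Forbidden m 𝓕) where
    open LowerBound {k} {p} {m} {n} {Forbidden} {toℕ r} inL notInL system noClique

    fromAvoiding : ∀ {a} → Avoiding everything (totalLoss k * m ^ a) →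
      -- The successor makes the constant visibly positive, as its inverse requires.
      Σ[ 𝓕′ ∈ List (Subset n) ] 𝓕′ ⊆ 𝓕 × Avoids Forbidden 𝓕′ × length 𝓕 ≤ suc (totalLoss k) * m ^ a * length 𝓕′
    fromAvoiding {a} A = subfamily , sublist , avoids , ≤-trans (≤-reflexive length≡count)
      (≤-trans large (*-monoˡ-≤ (length subfamily) (*-monoˡ-≤ (m ^ a) (n≤1+n (totalLoss k)))))
      where open Avoiding A

    lowerResidue = fromAvoiding {(k + (p ∸ 1)) / p + 1} (residueBound p≤k)

    lowerMultiples : ∀ j → toℕ r ≡ 0 → j * p ≡ k →
      Σ[ 𝓕′ ∈ List (Subset n) ] 𝓕′ ⊆ 𝓕 × Avoids Forbidden 𝓕′ × length 𝓕 ≤ suc (totalLoss k) * m ^ j * length 𝓕′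
    lowerMultiples j r≡0 jp≡k = fromAvoiding {j} (multiplesBound j (trans (m<n⇒m%n≡m (>-nonZero⁻¹ p)) (sym r≡0)) jp≡k)

  lowerGeneral : LowerBd k Forbidden m (inv (suc (totalLoss k)) · m ^- (⌈ k / p ⌉[ pr ] + 1))
  lowerGeneral = lowerBd {P = Forbidden} (suc (totalLoss k)) (⌈ k / p ⌉[ pr ] + 1) Lower.lowerResidue

  lowerNonzero : toℕ r ≡ 0 → p ∣ k → LowerBd k Forbidden m (inv (suc (totalLoss k)) · m ^- ⌊ k / p ⌋[ pr ])
  lowerNonzero r≡0 p∣k = lowerBd {P = Forbidden} (suc (totalLoss k)) (k / p) (λ system noClique → Lower.lowerMultiples system noClique (k / p) r≡0 (m/n*n≡m p∣k))

  -- Admissibility is tested on the words of length `k′` over the chosen alphabet. They contain no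
  -- clique of size `m`, so `α` times their number is at most the size of an independent set.
  upperBd : ∀ {k′ a} → 0 < k′ → k′ ≤ k → k′ % p ≡ toℕ r → a ≤ k′ / p →
    UpperBd k Forbidden m (ℕ→ℚ (suc (upperConstant k)) · m ^- a)
  upperBd {k′} {a} 0<k′ k′≤k k′≡r a≤ α 0≤α admissible
    with chooseAlphabet k′ (p ∸ 1) 0<k′ (m<n⇒0<n∸m (nonTrivial⇒n>1 p {{prime⇒nonTrivial pr}})) m
  ... | n , 0<n , small , m≤ = bound
    where
    instance
      _ = >-nonZero 0<n
    open Family pr {k} {k′} {n} 0<k′ k′≤k
    inL′ : ∀ {ℓ} → ℓ < k → ℓ % p ≢ k′ % p → Forbidden ℓ
    inL′ ℓ<k ≢ = inL _ ℓ<k (≢ ∘ λ eq → trans eq (sym k′≡r))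
    notInL′ : ∀ {ℓ} → Forbidden ℓ → ℓ % p ≢ k′ % p
    notInL′ forbidden eq = notInL _ (trans eq k′≡r) forbidden
    noClique : ¬ HasClique Forbidden m family
    noClique clique = [ (λ n≡1 → <-irrefl refl (≤-trans 2≤m (≤-trans (proj₂ bounds) (≤-reflexive (trans (cong (_^ k′) n≡1) (^-zeroˡ k′)))))) ,
                        (λ bound<m → <-irrefl refl (≤-trans bound<m (proj₁ bounds))) ]′ small
      where bounds = clique-bound inL′ notInL′ clique
    bound : α ℚ.≤ ℕ→ℚ (suc (upperConstant k)) · m ^- a
    bound with admissible _ family system noClique
    ... | 𝓖 , 𝓖⊆ , avoids , α≤ = ≤-fraction {b = length 𝓖} (n ^ k′) (m ^ a) (suc (upperConstant k)) {{m^n≢0 n k′}} {{m^n≢0 m a}}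
      (subst (λ N → α ℚ.* ℕ→ℚ N ℚ.≤ ℕ→ℚ (length 𝓖)) length-family α≤)
      (≤-trans (*-monoˡ-≤ (m ^ a) (avoiding-bound inL′ notInL′ 𝓖⊆ avoids))
        (≤-trans (alphabet-arithmetic {p} {k} {k′} 0<n 0<k′ k′≤k a≤ (≤-trans (s≤s z≤n) 2≤m) m≤) (*-monoˡ-≤ (n ^ k′) (n≤1+n (upperConstant k)))))

  upperNonzero : toℕ r ≡ 0 → p ∣ k → UpperBd k Forbidden m (ℕ→ℚ (suc (upperConstant k)) · m ^- ⌊ k / p ⌋[ pr ])
  upperNonzero r≡0 p∣k = upperBd (≤-trans (>-nonZero⁻¹ p) p≤k) ≤-refl (trans (n∣m⇒m%n≡0 k p p∣k) (sym r≡0)) ≤-refl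

  -- The largest k′ ≤ k congruent to the missing residue r.
  upperGeneral : UpperBd k Forbidden m (ℕ→ℚ (suc (upperConstant k)) · m ^- (⌊ k / p ⌋[ pr ] ∸ 1))
  upperGeneral = upperBd {k ∸ d} (m<n⇒0<n∸m (≤-trans d<p p≤k)) (m∸n≤m k d) residue quotients
    where
    -- Modulo `p`, `s` is `- r`; so `d` is the residue of `k - r`, and subtracting it from `k`
    -- leaves residue `r`.
    s = p ∸ toℕ r
    d = (k + s) % p
    q = (k + s) / p
    d<p : d < p
    d<p = m%n<n (k + s) p
    k′+d≡k : (k ∸ d) + d ≡ k
    k′+d≡k = m∸n+n≡m (≤-trans (<⇒≤ d<p) p≤k)
    k′+s≡qp : (k ∸ d) + s ≡ q * p
    k′+s≡qp = +-cancelˡ-≡ d _ _ (begin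
      d + ((k ∸ d) + s)      ≡⟨ sym (+-assoc d (k ∸ d) s) ⟩
      d + (k ∸ d) + s        ≡⟨ cong (_+ s) (trans (+-comm d (k ∸ d)) k′+d≡k) ⟩
      k + s                  ≡⟨ m≡m%n+[m/n]*n (k + s) p ⟩
      d + q * p              ∎)
      where open ≡-Reasoning
    residue : (k ∸ d) % p ≡ toℕ r
    residue = begin
      (k ∸ d) % p                  ≡⟨ sym ([m+n]%n≡m%n (k ∸ d) p) ⟩
      ((k ∸ d) + p) % p            ≡⟨ cong (λ t → ((k ∸ d) + t) % p) (sym (m∸n+n≡m (<⇒≤ (toℕ<n r)))) ⟩
      ((k ∸ d) + (s + toℕ r)) % p  ≡⟨ cong (_% p) (sym (+-assoc (k ∸ d) s (toℕ r))) ⟩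
      ((k ∸ d) + s + toℕ r) % p    ≡⟨ cong (λ t → (t + toℕ r) % p) k′+s≡qp ⟩
      (q * p + toℕ r) % p          ≡⟨ cong (_% p) (+-comm (q * p) (toℕ r)) ⟩
      (toℕ r + q * p) % p          ≡⟨ [m+kn]%n≡m%n (toℕ r) q p ⟩
      toℕ r % p                    ≡⟨ m<n⇒m%n≡m (toℕ<n r) ⟩
      toℕ r                        ∎
      where open ≡-Reasoning
    -- Since `d < p`, passing from `k` to `k ∸ d` lowers the quotient by at most one.
    quotients : k / p ∸ 1 ≤ (k ∸ d) / p
    quotients = m≤n+o⇒m∸n≤o (k / p) 1 (begin
      k / p                        ≤⟨ /-monoˡ-≤ p (≤-trans (≤-reflexive (sym k′+d≡k)) (+-monoʳ-≤ (k ∸ d) (<⇒≤ d<p))) ⟩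
      ((k ∸ d) + p) / p            ≡⟨ +-distrib-/-∣ʳ (k ∸ d) ∣-refl ⟩
      (k ∸ d) / p + p / p          ≡⟨ trans (cong ((k ∸ d) / p +_) (n/n≡1 p)) (+-comm _ 1) ⟩
      1 + (k ∸ d) / p              ∎)
      where open ≤-Reasoning

nonzeroRes-missing : ∀ p (pr : Prime p) → let instance _ = prime⇒nonZero pr in
  MissingOnly (nonzeroRes p pr) (0 mod p)
nonzeroRes-missing p pr = (λ x∈ → x∈∁p⇒x∉p x∈ (x∈⁅x⁆ _)) , λ x≢ → x∉p⇒x∈∁p (λ x∈ → x≢ (x∈⁅y⁆⇒x≡y _ x∈))
  where instance _ = prime⇒nonZero pr

theorem1p4 : (k : ℕ) → Σ ℚ λ c → Σ ℚ λ C → 0ℚ ℚ.< c × 0ℚ ℚ.< C ×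
    ((p : ℕ) (pr : Prime p) → p ≤ k → (m : ℕ) → 2 ≤ m →
    ((L : Subset p) → ∣ L ∣ ≡ p ∸ 1 →
    LowerBd k (InL' k p pr L) m (c · m ^- (⌈ k / p ⌉[ pr ] + 1))
    × UpperBd k (InL' k p pr L) m (C · m ^- (⌊ k / p ⌋[ pr ] ∸ 1)))
    × (p ∣ k →
    LowerBd k (InL' k p pr (nonzeroRes p pr)) m (c · m ^- ⌊ k / p ⌋[ pr ])
    × UpperBd k (InL' k p pr (nonzeroRes p pr)) m (C · m ^- ⌊ k / p ⌋[ pr ])))
theorem1p4 k = inv (suc (totalLoss k)) , ℕ→ℚ (suc (upperConstant k)) , 0<ratio 0 (totalLoss k) , 0<ratio (upperConstant k) 0 ,
  λ p pr p≤k m 2≤m → let instance _ = prime⇒nonZero pr in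
    (λ L ∣L∣ → let r , misses = missing L (trans (cong suc ∣L∣) (suc-pred p)) in
      lowerGeneral pr p≤k 2≤m misses , upperGeneral pr p≤k 2≤m misses) ,
    (λ p∣k → let misses = nonzeroRes-missing p pr
                 zero≡ = trans (toℕ-fromℕ< (m%n<n 0 p)) (m<n⇒m%n≡m (>-nonZero⁻¹ p)) in
      lowerNonzero pr p≤k 2≤m misses zero≡ p∣k , upperNonzero pr p≤k 2≤m misses zero≡ p∣k)
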